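{- The logic $\mathsf{TLCGA}^+$ has the finite model property: every satisfiable formula (state formula) of $\mathsf{TLCGA}^+$ is satisfiable in a concurrent game model in which both the set of states and the set of actions are finite.
   Context: **Models.** Fix a finite set $\mathsf{Agt}$ of agents and a set $\mathsf{AP}$ of atomic propositions; a coalition is any subset of $\mathsf{Agt}$. A game form over an outcome set $O$ is $(\mathsf{Act},\mathsf{act},O,\mathsf{out})$ with $\mathsf{Act}\ne\emptyset$, $\mathsf{act}$ assigning to each agent $a$ a non-empty set $\mathsf{act}_a\subseteq\mathsf{Act}$, and $\mathsf{out}:\prod_{a\in\mathsf{Agt}}\mathsf{act}_a\to O$. A concurrent game model is $\mathcal M=(S,\mathsf{Act},\mathfrak g,V)$ with $S\neq\emptyset$ a set of states, $\mathfrak g$ assigning to each $w\in S$ a game form $(\mathsf{Act},\mathsf{act}_w,S,\mathsf{out}_w)$ over $S$, and $V:\mathsf{AP}\to\mathcal P(S)$. A history is a finite word $w_0\zeta_0w_1\cdots\zeta_{n-1}w_n$ ($n\ge 0$) with $w_i\in S$ and $\zeta_i\in\prod_a\mathsf{act}_{w_i}(a)$. A strategy for $a$ maps each history ending in $w$ to an element of $\mathsf{act}_w(a)$; a strategy profile $\Sigma$ assigns a strategy to each agent. The play induced by $\Sigma$ at $w$ is $w_0\zeta_0w_1\zeta_1\cdots$ with $w_0=w$, $\zeta_n=\Sigma(w_0\zeta_0\cdots w_n)$, $w_{n+1}=\mathsf{out}_{w_n}(\zeta_n)$; its path is $w_0w_1w_2\cdots$. $\mathsf{paths}(w,\Sigma,C)$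 is the set of paths of plays induced at $w$ by strategy profiles $\Sigma'$ that agree with $\Sigma$ on all agents in $C$. **Language $\mathsf{TLCGA}^+$.** State formulas: $\varphi::=p\mid\top\mid\neg\varphi\mid(\varphi\wedge\varphi)\mid(\varphi\vee\varphi)\mid\langle\![\gamma]\!\rangle$; path formulas: $\theta::=\mathsf X\varphi\mid\varphi\,\mathsf U\,\varphi\mid\mathsf G\varphi\mid\theta\wedge\theta$; here $p\in\mathsf{AP}$ and $\gamma$ is a goal assignment, i.e. a map from $\mathcal P(\mathsf{Agt})$ to path formulas. **Semantics.** Booleans (including conjunction of path formulas) as usual. For a path $\pi=w_0w_1\cdots$: $\pi\Vdash\mathsf X\varphi$ iff $\varphi$ is true at $w_1$; $\pi\Vdash\varphi\,\mathsf U\,\psi$ iff for some $i$, $\psi$ is true at $w_i$ and $\varphi$ at all $w_j$, $j<i$; $\pi\Vdash\mathsf G\varphi$ iff $\varphi$ is true at all $w_i$. $\mathcal M,s\Vdash\langle\![\gamma]\!\rangle$ iff there is a strategy profile $\Sigma$ such that for every $C\subseteq\mathsf{Agt}$ and every $\pi\in\mathsf{paths}(s,\Sigma,C)$, $\pi\Vdash\gamma(C)$. A formula is satisfiable (in a model) if it is true at some state (of that model). -}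

module Defs where

open import Data.Fin.Base using (Fin)
open import Data.Fin.Subset using (Subset) renaming (_∈_ to _∈ₛ_)
open import Data.List.Base using (allFin)
open import Data.List.Relation.Unary.All using (All; universal)
open import Data.Nat.Base using (ℕ; zero; suc; _<_)
open import Data.Product.Base using (Σ; ∃-syntax; Σ-syntax; _×_; _,_; proj₁)
open import Data.Refinement.Base using (Refinement-syntax)
open import Data.Sum.Base using (_⊎_)
open import Data.Unit.Base using (⊤)
open import Function.Bundles using (_↔_)
open import Level using (0ℓ)
open import Relation.Binary.PropositionalEquality.Core using (_≡_; _≗_)
open import Relation.Nullary.Negation.Core using (¬_)
open import Relation.Unary using (Pred; _∈_)

-- The set of agents is Fin k throughout, and a coalition is a Subset k.

-- An action profile, i.e. an element of the product of the sets act a, is a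
-- tuple with one available action for each agent rather than a function.
-- Unlike for functions, componentwise equality then implies propositional
-- equality, so out and strategies depend only on which actions are chosen;
-- availability is proof-irrelevant for the same reason.
record GameForm (k : ℕ) (Act O : Set) : Set₁ where
  field
    act          : Fin k → Pred Act 0ℓ
    act-nonempty : ∀ a → ∃[ x ] x ∈ act a

  Action : Fin k → Set
  Action a = [ x ∈ Act ∣ x ∈ act a ]

  Profile : Set
  Profile = All Action (allFin k)

  field
    out : Profile → O

  profile : (∀ a → Action a) → Profile
  profile f = universal f (allFin k)

record Model (k : ℕ) (AP : Set) : Set₁ where
  field
    State          : Set
    Act            : Set
    state-nonempty : State
    Act-nonempty   : Act
    game           : State → GameForm k Act State
    V              : AP → Pred State 0ℓ

  module Game (w : State) = GameForm (game w)

module _ {k : ℕ} {AP : Set} (M : Model k AP) where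
  open Model M

  -- Histories indexed by their last state.  Consecutive states are not
  -- required to be linked by out.
  data History : State → Set where
    start  : (w : State) → History w
    extend : ∀ {w} → History w → Game.Profile w → (w′ : State) → History w′

  Strategy : Fin k → Set
  Strategy a = ∀ {w} → History w → Game.Action w a

  StrategyProfile : Set
  StrategyProfile = ∀ a → Strategy a

module _ {k : ℕ} {AP : Set} {M : Model k AP} where
  open Model M

  -- The prefix w₀ ζ₀ w₁ ⋯ wₙ of the induced play, paired with its last state wₙ.
  play : StrategyProfile M → State → ℕ → Σ State (History M)
  play Σ′ w zero    = w , start w
  play Σ′ w (suc n) =
    let (v , h) = play Σ′ w n
        ζ       = Game.profile v (λ a → Σ′ a h)
        v′      = Game.out v ζ
    in  v′ , extend h ζ v′

  path : StrategyProfile M → State → ℕ → State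
  path Σ′ w n = proj₁ (play Σ′ w n)

  AgreeOn : Subset k → StrategyProfile M → StrategyProfile M → Set
  AgreeOn C Σ₁ Σ₂ = ∀ a → a ∈ₛ C → ∀ {w} (h : History M w) → Σ₁ a h ≡ Σ₂ a h

  paths : State → StrategyProfile M → Subset k → Pred (ℕ → State) 0ℓ
  paths w Σ₀ C π = ∃[ Σ′ ] AgreeOn C Σ′ Σ₀ × π ≗ path Σ′ w

infix  8 ¬ᶠ_ X_ G_
infix  7 _U_
infixr 6 _∧ᶠ_ _∧ᵖ_
infixr 5 _∨ᶠ_

mutual
  data StateFormula (k : ℕ) (AP : Set) : Set where
    atom : AP → StateFormula k AP
    ⊤ᶠ   : StateFormula k AP
    ¬ᶠ_  : StateFormula k AP → StateFormula k AP
    _∧ᶠ_ : StateFormula k AP → StateFormula k AP → StateFormula k AP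
    _∨ᶠ_ : StateFormula k AP → StateFormula k AP → StateFormula k AP
    ⟨[_]⟩ : (Subset k → PathFormula k AP) → StateFormula k AP

  data PathFormula (k : ℕ) (AP : Set) : Set where
    X_   : StateFormula k AP → PathFormula k AP
    _U_  : StateFormula k AP → StateFormula k AP → PathFormula k AP
    G_   : StateFormula k AP → PathFormula k AP
    _∧ᵖ_ : PathFormula k AP → PathFormula k AP → PathFormula k AP

module _ {k : ℕ} {AP : Set} where

  infix 4 _,_⊨_ _,_⊩_

  mutual
    _,_⊨_ : (M : Model k AP) → Model.State M → StateFormula k AP → Set
    M , s ⊨ atom p   = s ∈ Model.V M p
    M , s ⊨ ⊤ᶠ       = ⊤
    M , s ⊨ (¬ᶠ φ)   = ¬ (M , s ⊨ φ)
    M , s ⊨ (φ ∧ᶠ ψ) = (M , s ⊨ φ) × (M , s ⊨ ψ)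
    M , s ⊨ (φ ∨ᶠ ψ) = (M , s ⊨ φ) ⊎ (M , s ⊨ ψ)
    M , s ⊨ ⟨[ γ ]⟩  = Σ[ Σ₀ ∈ StrategyProfile M ]
                         (∀ C π → π ∈ paths s Σ₀ C → M , π ⊩ γ C)

    _,_⊩_ : (M : Model k AP) → (ℕ → Model.State M) → PathFormula k AP → Set
    M , π ⊩ (X φ)    = M , π 1 ⊨ φ
    M , π ⊩ (φ U ψ)  = ∃[ i ] (M , π i ⊨ ψ) × (∀ j → j < i → M , π j ⊨ φ)
    M , π ⊩ (G φ)    = ∀ i → M , π i ⊨ φ
    M , π ⊩ (θ ∧ᵖ η) = (M , π ⊩ θ) × (M , π ⊩ η)

  SatisfiableIn : Model k AP → StateFormula k AP → Set
  SatisfiableIn M φ = ∃[ s ] (M , s ⊨ φ)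

  Satisfiable : StateFormula k AP → Set₁
  Satisfiable φ = ∃[ M ] SatisfiableIn M φ

Finite : Set → Set
Finite A = ∃[ n ] (A ↔ Fin n)

{-# OPTIONS --safe #-}
module Submission where

open import Defs
open import Axiom.ExcludedMiddle using (ExcludedMiddle)
open import Data.Bool.Base using (Bool; true; false; if_then_else_; _xor_)
open import Data.Bool.Properties using (xor-assoc; xor-comm; xor-same; xor-identityˡ)
open import Data.Empty using (⊥; ⊥-elim)
open import Data.Fin.Base using (Fin; zero; suc)
import Data.Fin.Properties as Fin
open import Data.Fin.Subset using (Subset; _⊆_) renaming (_∈_ to _∈ₛ_)
open import Data.Fin.Subset.Properties using (_⊆?_; _∈?_)
import Data.Irrelevant as Irrelevant
open import Data.List.Base as List using (List; []; _∷_; _++_; concatMap; cartesianProductWith)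
open import Data.List.Membership.Propositional using (_∈_; find; lose)
open import Data.List.Membership.Propositional.Properties using
  ( ∈-map⁺; ∈-map⁻; ∈-++⁺ˡ; ∈-++⁺ʳ; ∈-++⁻; ∈-concatMap⁺; ∈-concatMap⁻
  ; ∈-cartesianProductWith⁺; ∈-cartesianProductWith⁻; ∈-allFin; ∈-lookup )
import Data.List.Properties as Listₚ
open import Data.List.Relation.Binary.Subset.Propositional using () renaming (_⊆_ to _⊆ˡ_)
open import Data.List.Relation.Unary.All as All using (All; []; _∷_; universal)
import Data.List.Relation.Unary.All.Properties as Allₚ
open Allₚ using (tabulate⁻)
open import Data.List.Relation.Unary.Any using (here; there; index)
open import Data.List.Relation.Unary.Any.Properties using (lookup-index)
open import Data.Maybe.Base as Maybe using (Maybe; just; nothing)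
open import Data.Maybe.Relation.Unary.Any using (Any; just)
open import Data.Nat.Base using (ℕ; zero; suc; _+_; _<_; _≤_; _⊔_; z≤n; s≤s)
open import Data.Nat.ListAction using (sum)
open import Data.Nat.Properties using
  ( ≤-refl; ≤-trans; ≤-pred; <-trans; <-cmp; <-≤-trans; m≤m⊔n; m≤n⊔m; m≤n⇒m≤1+n; m≤n⇒m<n∨m≡n
  ; +-monoʳ-<; +-monoˡ-<; +-mono-< )
open import Data.Product.Base using (Σ; Σ-syntax; ∃; ∃-syntax; _×_; _,_; proj₁; proj₂)
open import Data.Product.Function.NonDependent.Propositional using (_×-⇔_)
import Data.Refinement.Base as Refinement
open import Data.Sum.Base using (_⊎_; inj₁; inj₂; [_,_]′)
open import Data.Sum.Function.Propositional using (_⊎-⇔_)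
open import Data.Unit.Base using (⊤; tt)
import Data.Vec.Base as Vec
open Vec using (Vec; []; _∷_)
import Data.Vec.Properties as Vecₚ
open import Function.Base using (id; _∘_; case_of_)
open import Function.Bundles using (_⇔_; mk⇔; Equivalence)
open import Function.Construct.Composition using (_⇔-∘_)
open import Function.Construct.Identity using (↔-id)
open import Function.Construct.Symmetry using (⇔-sym)
open import Level using (0ℓ)
open import Relation.Binary.Definitions using (tri<; tri≈; tri>)
open import Relation.Binary.PropositionalEquality
open import Relation.Nullary using (¬_; Dec; yes; no; does; contradiction)
open import Relation.Nullary.Decidable using (decidable-stable; dec-true)

-- Every path goal is an until or weak-until condition, possibly delayed by one
-- step, so ⟨[ γ ]⟩ asks for a play of a finite obligation: a list of monitors,
-- where those of a coalition are discharged once a member leaves it.  An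
-- obligation can be achieved iff it has a winning derivation built from a least
-- fixed point (discharging the untils) over a greatest one (staying sound).
--
-- Two states have the same type if they can achieve the same obligations.  At
-- each state the real game is replaced by a finite one where an agent either
-- follows a fixed profile for an obligation or votes for a type; any single
-- agent can swing the vote, so whatever the agents outside a coalition can do
-- in the real game they can do, up to types, in the finite one.  Along a
-- well-founded derivation these games form a finite tree, which serves the
-- obligation until it changes.  The finite model consists of one such tree for
-- each obligation and type; a play that leaves a tree enters one for its
-- current type and the next obligation in cyclic order.  As obligations change
-- only finitely often, each one is served in the end.

-- Action profiles as tuples and as functions.

tabulate⁻-universal : ∀ {A : Set} {P : A → Set} (f : ∀ x → P x) {n} (g : Fin n → A) i →
  tabulate⁻ (universal f (List.tabulate g)) i ≡ f (g i)
tabulate⁻-universal f g zero    = refl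
tabulate⁻-universal f g (suc i) = tabulate⁻-universal f (g ∘ suc) i

tabulate⁻-injective : ∀ {A : Set} {P : A → Set} {n} {g : Fin n → A} (xs ys : All P (List.tabulate g)) →
  (∀ i → tabulate⁻ {f = g} xs i ≡ tabulate⁻ ys i) → xs ≡ ys
tabulate⁻-injective {n = zero}  []       []       eq = refl
tabulate⁻-injective {n = suc n} (x ∷ xs) (y ∷ ys) eq =
  cong₂ _∷_ (eq zero) (tabulate⁻-injective xs ys (eq ∘ suc))

-- Monitors for until and weak-until conditions.

data Status : Set where
  waiting active done : Status

-- The weak-until (weak = true) or until (weak = false) condition
-- "hold until goal", imposed on the plays that follow coalition coal.
record Component (k : ℕ) (AP : Set) : Set where
  constructor component
  field
    coal : Subset k
    weak : Bool
    hold : StateFormula k AP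
    goal : StateFormula k AP
open Component

module Monitor (em : ExcludedMiddle 0ℓ) (k : ℕ) (AP : Set) where

  Comp : Set
  Comp = Component k AP

  Obligation : Set
  Obligation = List (Comp × Status)

  Truth : Set₁
  Truth = StateFormula k AP → Set

  Sound₁ : Truth → Comp × Status → Set
  Sound₁ ρ (c , active) = ρ (hold c) ⊎ ρ (goal c)
  Sound₁ ρ (c , _)      = ⊤

  Accepting₁ : Comp × Status → Set
  Accepting₁ (c , waiting) = ⊥
  Accepting₁ (c , active)  = weak c ≡ true
  Accepting₁ (c , done)    = ⊤

  advance : Truth → Comp → Status → Status
  advance ρ c waiting = active
  advance ρ c active  = if does (em {ρ (goal c)}) then done else active
  advance ρ c done    = done

  -- A component whose coalition has been left by some member is discharged.
  keep : Bool → Status → Status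
  keep true  s = s
  keep false s = done

  next₁ : Truth → Subset k → Comp → Status → Status
  next₁ ρ A c s = keep (does (coal c ⊆? A)) (advance ρ c s)

  Sound : Truth → Obligation → Set
  Sound ρ = All (Sound₁ ρ)

  Accepting : Obligation → Set
  Accepting = All Accepting₁

  next : Truth → Subset k → Obligation → Obligation
  next ρ A = List.map (λ (c , s) → c , next₁ ρ A c s)

  next₁-kept : ∀ ρ {A} c s → coal c ⊆ A → next₁ ρ A c s ≡ advance ρ c s
  next₁-kept ρ {A} c s C⊆A rewrite dec-true (coal c ⊆? A) C⊆A = refl

  next₁-done : ∀ ρ A c → next₁ ρ A c done ≡ done
  next₁-done ρ A c with does (coal c ⊆? A)
  ... | true  = refl
  ... | false = refl

  next₁-undone : ∀ ρ A c s → next₁ ρ A c s ≢ done → coal c ⊆ A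
  next₁-undone ρ A c s ≢done with coal c ⊆? A
  ... | yes C⊆A = C⊆A
  ... | no  _   = contradiction refl ≢done

  -- An accepting status is `done` or weakly `active`; meeting the goal or losing a member of the
  -- coalition only leads to `done`.
  next₁-accepting : ∀ ρ A c s → Accepting₁ (c , s) → Accepting₁ (c , next₁ ρ A c s)
  next₁-accepting ρ A c s acc with does (coal c ⊆? A)
  ... | false = tt
  next₁-accepting ρ A c done   acc | true = tt
  next₁-accepting ρ A c active acc | true with does (em {ρ (goal c)})
  ... | true  = tt
  ... | false = acc

  next-accepting : ∀ ρ A {o} → Accepting o → Accepting (next ρ A o)
  next-accepting ρ A []                    = []
  next-accepting ρ A {(c , s) ∷ _} (x ∷ acc) = next₁-accepting ρ A c s x ∷ next-accepting ρ A acc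

  -- The monitor on a play that the coalition follows throughout, hence with no discharge.
  run : (ℕ → Truth) → Comp → Status → ℕ → Status
  run r c s zero    = s
  run r c s (suc n) = advance (r n) c (run r c s n)

  Satisfied : (ℕ → Truth) → Comp × Status → Set
  Satisfied r (c , s) = (∀ n → Sound₁ (r n) (c , run r c s n)) × ∃[ n ] Accepting₁ (c , run r c s n)

  run-cong : ∀ {r r′} → r ≗ r′ → ∀ c s n → run r c s n ≡ run r′ c s n
  run-cong eq c s zero    = refl
  run-cong eq c s (suc n) = cong₂ (λ ρ → advance ρ c) (eq n) (run-cong eq c s n)

  satisfied-resp : ∀ {r r′} → r ≗ r′ → ∀ c s → Satisfied r (c , s) → Satisfied r′ (c , s)
  satisfied-resp eq c s (sound , n , acc) =
      (λ m → subst₂ (λ ρ x → Sound₁ ρ (c , x)) (eq m) (run-cong eq c s m) (sound m))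
    , n , subst (λ x → Accepting₁ (c , x)) (run-cong eq c s n) acc

  stable : {A : Set} → ¬ ¬ A → A
  stable = decidable-stable em

  comprehension : (Fin k → Set) → Subset k
  comprehension P = Vec.tabulate (λ a → does (em {P a}))

  ∈-comprehension⁺ : ∀ {P : Fin k → Set} {a} → P a → a ∈ₛ comprehension P
  ∈-comprehension⁺ {P} {a} Pa = Vecₚ.lookup⇒[]= a _
    (trans (Vecₚ.lookup∘tabulate _ a) (dec-true em Pa))

  ∈-comprehension⁻ : ∀ {P : Fin k → Set} {a} → a ∈ₛ comprehension P → P a
  ∈-comprehension⁻ {P} {a} a∈
    with em {P a} | trans (sym (Vecₚ.lookup∘tabulate (λ a → does (em {P a})) a)) (Vecₚ.[]=⇒lookup a∈)
  ... | yes Pa | _ = Pa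

-- Achievability as a least fixed point over a greatest one.

module Fixpoints (em : ExcludedMiddle 0ℓ) {k : ℕ} {AP : Set} (M : Model k AP)
  (ρ : Model.State M → StateFormula k AP → Set) where

  open Model M
  open Monitor em k AP

  choice : ∀ w → Game.Profile w → ∀ a → Game.Action w a
  choice w ζ = tabulate⁻ {f = id} ζ

  choice-profile : ∀ w f a → choice w (Game.profile w f) a ≡ f a
  choice-profile w f a = tabulate⁻-universal f id a

  choice-injective : ∀ w {ζ ζ′} → (∀ a → choice w ζ a ≡ choice w ζ′ a) → ζ ≡ ζ′
  choice-injective w = tabulate⁻-injective {g = id} _ _

  someProfile : ∀ w → Game.Profile w
  someProfile w = Game.profile w λ a →
    let x , x∈act = Game.act-nonempty w a in x Refinement., Irrelevant.[ x∈act ]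

  Agree : ∀ w → Subset k → Game.Profile w → Game.Profile w → Set
  Agree w A ζ ζ′ = ∀ a → a ∈ₛ A → choice w ζ a ≡ choice w ζ′ a

  -- Only meaningful for accepting o, where nothing but a loss of soundness can
  -- violate the obligation.
  data Bad (o : Obligation) (w : State) : Set where
    fail  : ¬ Sound (ρ w) o → Bad o w
    force : (reply : Game.Profile w → Game.Profile w) (A : Game.Profile w → Subset k) →
            (∀ ζ → Agree w (A ζ) ζ (reply ζ)) →
            (∀ ζ → Bad (next (ρ w) (A ζ) o) (Game.out w (reply ζ))) →
            Bad o w

  -- Since `Bad` is inductive, its negation serves as the greatest fixed point of staying sound. The
  -- untils are discharged by finitely many uses of `later` along each play before `now`.
  data Achievable (o : Obligation) (w : State) : Set where
    now   : Accepting o → ¬ Bad o w → Achievable o w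
    later : Sound (ρ w) o → (ζ : Game.Profile w) →
            (∀ ζ′ A → Agree w A ζ ζ′ → Achievable (next (ρ w) A o) (Game.out w ζ′)) →
            Achievable o w

  ¬achievable⇒bad : ∀ {o w} → Accepting o → ¬ Achievable o w → Bad o w
  ¬achievable⇒bad acc ¬ach = stable (λ ¬bad → ¬ach (now acc ¬bad))

  -- Playing the two derivations against each other gives a single play along which both descend,
  -- until soundness is both asserted and denied.
  achievable⇒¬bad : ∀ {o w} → Accepting o → Achievable o w → ¬ Bad o w
  achievable⇒¬bad acc (now _ ¬bad)    bad = ¬bad bad
  achievable⇒¬bad acc (later snd ζ f) (fail ¬snd) = ¬snd snd
  achievable⇒¬bad acc (later snd ζ f) (force reply A agr sub) =
    achievable⇒¬bad (next-accepting _ (A ζ) acc) (f (reply ζ) (A ζ) (agr ζ)) (sub ζ)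

  Move : (Obligation → State → Set) → Obligation → State → Set
  Move P o w = Σ[ ζ ∈ Game.Profile w ]
    (∀ ζ′ A → Agree w A ζ ζ′ → P (next (ρ w) A o) (Game.out w ζ′))

  Reply : (Obligation → State → Set) → Obligation → (w : State) → Game.Profile w → Set
  Reply P o w ζ = Σ[ ζ′ ∈ Game.Profile w ] Σ[ A ∈ Subset k ]
    Agree w A ζ ζ′ × P (next (ρ w) A o) (Game.out w ζ′)

  ¬move⇒reply : ∀ (P : Obligation → State → Set) o {w} → ¬ Move P o w →
    ∀ ζ → Reply (λ o w → ¬ P o w) o w ζ
  ¬move⇒reply P o ¬move ζ = stable λ ¬reply →
    ¬move (ζ , λ ζ′ A agr → stable λ ¬P → ¬reply (ζ′ , A , agr , ¬P))

  -- This unfolds the greatest fixed point: if each profile had a bad reply, these replies would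
  -- assemble into `force`.
  ¬bad⇒move : ∀ {o w} → ¬ Bad o w → Sound (ρ w) o × Move (λ o w → ¬ Bad o w) o w
  ¬bad⇒move {o} {w} ¬bad = stable (λ ¬snd → ¬bad (fail ¬snd)) , stable λ ¬move →
    let reply = ¬move⇒reply (λ o w → ¬ Bad o w) o ¬move in
    ¬bad (force (λ ζ → proj₁ (reply ζ)) (λ ζ → proj₁ (proj₂ (reply ζ)))
                (λ ζ → proj₁ (proj₂ (proj₂ (reply ζ))))
                (λ ζ → stable (proj₂ (proj₂ (proj₂ (reply ζ))))))

  achievable⇒move : ∀ {o w} → Achievable o w → Sound (ρ w) o × Move Achievable o w
  achievable⇒move (now acc ¬bad) with ¬bad⇒move ¬bad
  ... | snd , ζ , f = snd , ζ , λ ζ′ A agr → now (next-accepting _ A acc) (f ζ′ A agr)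
  achievable⇒move (later snd ζ f) = snd , ζ , f

  ¬achievable⇒reply : ∀ {o w} → ¬ Achievable o w → Sound (ρ w) o →
    ∀ ζ → Reply (λ o w → ¬ Achievable o w) o w ζ
  ¬achievable⇒reply {o} ¬ach snd = ¬move⇒reply Achievable o λ (ζ , f) → ¬ach (later snd ζ f)

  -- From a winning derivation to a strategy profile.

  Enforces : StrategyProfile M → Obligation → State → Set
  Enforces Σ₀ o s = ∀ {c st} → (c , st) ∈ o → ∀ π → paths s Σ₀ (coal c) π →
    Satisfied (ρ ∘ π) (c , st)

  module Follow {o₀ : Obligation} {s : State} (ach₀ : Achievable o₀ s) where

    Claim : State → Set
    Claim w = ∃[ o ] Achievable o w

    idle : ∀ w → Claim w
    idle w = [] , now [] (¬bad w)
      where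
      ¬bad : ∀ w → ¬ Bad [] w
      ¬bad w (fail ¬snd)          = ¬snd []
      ¬bad w (force reply _ _ sub) = ¬bad _ (sub (someProfile w))

    respond : ∀ {w} → Claim w → Game.Profile w
    respond (o , ach) = proj₁ (proj₂ (achievable⇒move ach))

    loyal : ∀ {w} → Claim w → Game.Profile w → Subset k
    loyal {w} cl ζ = comprehension (λ a → choice w (respond cl) a ≡ choice w ζ a)

    follow : ∀ {w} (cl : Claim w) ζ → Claim (Game.out w ζ)
    follow {w} cl ζ = next (ρ w) (loyal cl ζ) (proj₁ cl) ,
      proj₂ (proj₂ (achievable⇒move (proj₂ cl))) ζ (loyal cl ζ) (λ a → ∈-comprehension⁻)

    -- The current obligation and its derivation are recomputed from the history. Where the history
    -- cannot belong to a play from `s`, the empty obligation takes over.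
    track : ∀ {w} → History M w → Claim w
    track (start w) with em {w ≡ s}
    ... | yes refl = o₀ , ach₀
    ... | no  _    = idle w
    track (extend {w} h ζ w′) with em {w′ ≡ Game.out w ζ}
    ... | yes refl = follow (track h) ζ
    ... | no  _    = idle w′

    track-start : track (start s) ≡ (o₀ , ach₀)
    track-start with em {s ≡ s}
    ... | yes refl = refl
    ... | no  s≢s  = contradiction refl s≢s

    track-extend : ∀ {w} (h : History M w) ζ → track (extend h ζ (Game.out w ζ)) ≡ follow (track h) ζ
    track-extend {w} h ζ with em {Game.out w ζ ≡ Game.out w ζ}
    ... | yes refl = refl
    ... | no  w≢w  = contradiction refl w≢w

    strategy : StrategyProfile M
    strategy a {w} h = choice w (respond (track h)) a

    module _ {c : Comp} {st : Status} (c∈ : (c , st) ∈ o₀) (Σ′ : StrategyProfile M)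
      (agr : AgreeOn {M = M} (coal c) Σ′ strategy) where

      state = path {M = M} Σ′ s

      hist : ∀ n → History M (state n)
      hist n = proj₂ (play {M = M} Σ′ s n)

      move : ∀ n → Game.Profile (state n)
      move n = Game.profile (state n) (λ a → Σ′ a (hist n))

      claim : ∀ n → Claim (state n)
      claim n = track (hist n)

      claim-suc : ∀ n → claim (suc n) ≡ follow (claim n) (move n)
      claim-suc n = track-extend (hist n) (move n)

      status : ℕ → Status
      status = run (ρ ∘ state) c st

      kept : ∀ n → coal c ⊆ loyal (claim n) (move n)
      kept n {a} a∈ = ∈-comprehension⁺ (trans (sym (agr a a∈ (hist n))) (sym (choice-profile _ _ a)))

      present : ∀ n → (c , status n) ∈ proj₁ (claim n)
      present zero    rewrite track-start = c∈
      present (suc n) rewrite claim-suc n =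
        subst (λ x → (c , x) ∈ _) (next₁-kept _ c (status n) (kept n)) (∈-map⁺ _ (present n))

      sound : ∀ n → Sound₁ (ρ (state n)) (c , status n)
      sound n = All.lookup (proj₁ (achievable⇒move (proj₂ (claim n)))) (present n)

      -- Each step of the play replaces the tracked derivation by a subderivation, so `now` is
      -- reached. The equation keeps `claim n` in step with the derivation on which the recursion
      -- runs.
      accepted : ∀ n {o} (ach : Achievable o (state n)) → claim n ≡ (o , ach) →
        ∃[ m ] Accepting₁ (c , status m)
      accepted n (now acc _) eq = n , All.lookup acc (subst (λ cl → (c , status n) ∈ proj₁ cl) eq (present n))
      accepted n {o} (later snd ζ f) eq =
        accepted (suc n) (f (move n) (loyal (o , later snd ζ f) (move n)) (λ a → ∈-comprehension⁻))
          (trans (claim-suc n) (cong (λ cl → follow cl (move n)) eq))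

    enforces : Enforces strategy o₀ s
    enforces {c} {st} c∈ π (Σ′ , agr , π≗) =
      satisfied-resp (λ n → cong ρ (sym (π≗ n))) c st
        (sound c∈ Σ′ agr , accepted c∈ Σ′ agr 0 ach₀ track-start)

-- From a strategy profile to a winning derivation, by an adversarial play.

module Adversary (em : ExcludedMiddle 0ℓ) {k : ℕ} {AP : Set} (M : Model k AP)
  (ρ : Model.State M → StateFormula k AP → Set) where

  open Model M
  open Monitor em k AP
  open Fixpoints em M ρ

  -- `bad` holds a derivation to descend, `pending` keeps an undischarged until from being achieved,
  -- and `idle` is a filler for positions after soundness was lost.
  data Hostile (o : Obligation) (w : State) : Set where
    bad  : Bad o w → Hostile o w
    pending : ¬ Accepting o → ¬ Achievable o w → Hostile o w
    idle : Hostile o w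

  hostile : ∀ {o w} → ¬ Achievable o w → Hostile o w
  hostile {o} ¬ach with em {Accepting o}
  ... | yes acc = bad (¬achievable⇒bad acc ¬ach)
  ... | no ¬acc = pending ¬acc ¬ach

  counter : ∀ {o w} → Hostile o w → ∀ ζ → Reply Hostile o w ζ
  counter {o} {w} (pending ¬acc ¬ach) ζ with em {Sound (ρ w) o}
  ... | yes snd = let ζ′ , A , agr , ¬ach′ = ¬achievable⇒reply ¬ach snd ζ in
                  ζ′ , A , agr , hostile ¬ach′
  ... | no  _   = ζ , Vec.replicate k true , (λ _ _ → refl) , idle
  counter (bad (force reply A agr sub)) ζ = reply ζ , A ζ , agr ζ , bad (sub ζ)
  counter (bad (fail _)) ζ = ζ , Vec.replicate k true , (λ _ _ → refl) , idle
  counter idle ζ = ζ , Vec.replicate k true , (λ _ _ → refl) , idle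

  length : ∀ {w} → History M w → ℕ
  length (start w)       = 0
  length (extend h _ _) = suc (length h)

  module Refute {o₀ : Obligation} {s : State} (Σ₀ : StrategyProfile M)
    (enforces : Enforces Σ₀ o₀ s) (¬ach : ¬ Achievable o₀ s) where

    record Position : Set where
      constructor position
      field
        {state} : State
        hist    : History M state
        obl     : Obligation
        hostility : Hostile obl state

    module _ (p : Position) where
      open Position p

      intended : Game.Profile state
      intended = Game.profile state (λ a → Σ₀ a hist)

      reply : Game.Profile state
      reply = proj₁ (counter hostility intended)

      loyal : Subset k
      loyal = proj₁ (proj₂ (counter hostility intended))

      loyal-agree : Agree state loyal intended reply
      loyal-agree = proj₁ (proj₂ (proj₂ (counter hostility intended)))

      successor : Position
      successor = position (extend hist reply (Game.out state reply)) (next (ρ state) loyal obl)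
        (proj₂ (proj₂ (proj₂ (counter hostility intended))))

    pos : ℕ → Position
    pos zero    = position (start s) o₀ (hostile ¬ach)
    pos (suc n) = successor (pos n)

    open module Pos n = Position (pos n)

    length-hist : ∀ n → length (hist n) ≡ n
    length-hist zero    = refl
    length-hist (suc n) = cong suc (length-hist n)

    -- Unlike `run`, this also discharges a component when a member of its coalition deviates; the
    -- two coincide as long as nobody in the coalition does.
    status : Comp → Status → ℕ → Status
    status c st zero    = st
    status c st (suc n) = next₁ (ρ (state n)) (loyal (pos n)) c (status c st n)

    obl-status : ∀ n → obl n ≡ List.map (λ (c , st) → c , status c st n) o₀
    obl-status zero    = sym (Listₚ.map-id o₀)
    obl-status (suc n) = trans (cong (next _ _) (obl-status n)) (sym (Listₚ.map-∘ o₀))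

    -- The adversarial play is consistent with Σ₀ for every coalition that is
    -- never left; the opponents of that coalition replay it by its length.
    module _ (C : Subset k) where

      replay : ∀ m a {w} → History M w → Dec (w ≡ state m) → Game.Action w a
      replay m a h (yes refl) = choice (state m) (reply (pos m)) a
      replay m a h (no _)     = Σ₀ a h

      Σ′ : StrategyProfile M
      Σ′ a {w} h with a ∈? C
      ... | yes _ = Σ₀ a h
      ... | no  _ = replay (length h) a h em

      Σ′-agrees : AgreeOn {M = M} C Σ′ Σ₀
      Σ′-agrees a a∈ h with a ∈? C
      ... | yes _  = refl
      ... | no a∉ = contradiction a∈ a∉

      replay-hist : ∀ m n → m ≡ n → ∀ a → replay m a (hist n) em ≡ choice (state n) (reply (pos n)) a
      replay-hist n n refl a with em {state n ≡ state n}
      ... | yes refl = refl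
      ... | no  ≢    = contradiction refl ≢

      Σ′-replies : ∀ n → C ⊆ loyal (pos n) → ∀ a → Σ′ a (hist n) ≡ choice (state n) (reply (pos n)) a
      Σ′-replies n C⊆ a with a ∈? C
      ... | yes a∈ = trans (sym (choice-profile (state n) _ a)) (loyal-agree (pos n) a (C⊆ a∈))
      ... | no  a∉ = replay-hist (length (hist n)) n (length-hist n) a

      play-hist : ∀ n → (∀ m → m < n → C ⊆ loyal (pos m)) → play {M = M} Σ′ s n ≡ (state n , hist n)
      play-hist zero    C⊆ = refl
      play-hist (suc n) C⊆ rewrite play-hist n (λ m m<n → C⊆ m (m≤n⇒m≤1+n m<n)) =
        cong (λ ζ → Game.out (state n) ζ , extend (hist n) ζ (Game.out (state n) ζ))
          (choice-injective (state n) λ a →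
            trans (choice-profile (state n) _ a) (Σ′-replies n (C⊆ n ≤-refl) a))

    module _ {c : Comp} {st : Status} (c∈ : (c , st) ∈ o₀) where

      -- A departure makes the status `done`, and `done` persists.
      undone⇒loyal : ∀ n → status c st n ≢ done → ∀ m → m < n → coal c ⊆ loyal (pos m)
      undone⇒loyal (suc n) ≢done m m<1+n with m≤n⇒m<n∨m≡n (≤-pred m<1+n)
      ... | inj₁ m<n  = undone⇒loyal n (λ ≡done → ≢done (trans
                          (cong (next₁ (ρ (state n)) (loyal (pos n)) c) ≡done)
                          (next₁-done (ρ (state n)) (loyal (pos n)) c))) m m<n
      ... | inj₂ refl = next₁-undone (ρ (state n)) (loyal (pos n)) c (status c st n) ≢done

      ρ′ : ℕ → Truth
      ρ′ = ρ ∘ path {M = M} (Σ′ (coal c)) s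

      status-run : ∀ n → (∀ m → m < n → coal c ⊆ loyal (pos m)) → status c st n ≡ run ρ′ c st n
      status-run zero    C⊆ = refl
      status-run (suc n) C⊆
        rewrite play-hist (coal c) n (λ m m<n → C⊆ m (m≤n⇒m≤1+n m<n))
              | sym (status-run n (λ m m<n → C⊆ m (m≤n⇒m≤1+n m<n))) =
        next₁-kept _ c (status c st n) (C⊆ n ≤-refl)

      satisfied : Satisfied ρ′ (c , st)
      satisfied = enforces c∈ _ (Σ′ (coal c) , Σ′-agrees (coal c) , λ _ → refl)

      sound : ∀ n → Sound₁ (ρ (state n)) (c , status c st n)
      sound n with em {status c st n ≡ done}
      ... | yes ≡done rewrite ≡done = tt
      ... | no  ≢done = subst₂ (λ w x → Sound₁ (ρ w) (c , x))
                          (cong proj₁ (play-hist (coal c) n (undone⇒loyal n ≢done)))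
                          (sym (status-run n (undone⇒loyal n ≢done)))
                          (proj₁ satisfied n)

      -- If the component is never `done`, its coalition is never left, so the whole play is
      -- consistent with `Σ₀` on that coalition and `satisfied` provides the time.
      accepted : ∃[ n ] Accepting₁ (c , status c st n)
      accepted = stable λ ¬acc →
        let undone = λ n ≡done → ¬acc (n , subst (λ x → Accepting₁ (c , x)) (sym ≡done) tt)
            n , acc = proj₂ satisfied
        in ¬acc (n , subst (λ x → Accepting₁ (c , x)) (sym (status-run n (undone⇒loyal n (undone n)))) acc)

      accepted-later : ∀ {n} m → n ≤ m → Accepting₁ (c , status c st n) → Accepting₁ (c , status c st m)
      accepted-later m n≤m acc with m≤n⇒m<n∨m≡n n≤m
      accepted-later m       n≤m acc | inj₂ refl = acc
      accepted-later (suc m) n≤m acc | inj₁ n<m  =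
        next₁-accepting _ (loyal (pos m)) c _ (accepted-later m (≤-pred n<m) acc)

    obl-sound : ∀ n → Sound (ρ (state n)) (obl n)
    obl-sound n = subst (Sound _) (sym (obl-status n)) (Allₚ.map⁺ (All.tabulate λ c∈ → sound c∈ n))

    all-accepted : ∀ o → (∀ {x} → x ∈ o → x ∈ o₀) →
      ∃[ n ] (∀ m → n ≤ m → All (λ (c , st) → Accepting₁ (c , status c st m)) o)
    all-accepted []       ⊆o₀ = 0 , λ _ _ → []
    all-accepted (x ∷ o) ⊆o₀ with accepted (⊆o₀ (here refl)) | all-accepted o (⊆o₀ ∘ there)
    ... | i , acc | n , accs = i ⊔ n , λ m ≤m →
      accepted-later (⊆o₀ (here refl)) m (≤-trans (m≤m⊔n i n) ≤m) acc ∷ accs m (≤-trans (m≤n⊔m i n) ≤m)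

    -- From a `bad` position the play descends along the derivation of `Bad`, ending in a failure
    -- that `obl-sound` excludes.
    ¬bad : ∀ n {w} {h : History M w} {o} (b : Bad o w) → pos n ≢ position h o (bad b)
    ¬bad n (fail ¬snd) eq = ¬snd (subst (λ p → Sound (ρ (Position.state p)) (Position.obl p)) eq (obl-sound n))
    ¬bad n (force reply A agr sub) eq = ¬bad (suc n) (sub _) (cong successor eq)

    Live : ∀ {o w} → Hostile o w → Set
    Live idle = ⊥
    Live _    = ⊤

    hostile-live : ∀ {o w} (¬ach : ¬ Achievable o w) → Live (hostile ¬ach)
    hostile-live {o} ¬ach with em {Accepting o}
    ... | yes _ = tt
    ... | no  _ = tt

    successor-live : ∀ p →
      Sound (ρ (Position.state p)) (Position.obl p) → Live (Position.hostility p) →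
      Live (Position.hostility (successor p))
    successor-live (position h o (bad (fail ¬snd))) snd _ = ¬snd snd
    successor-live (position h o (bad (force _ _ _ _))) snd _ = tt
    successor-live (position {w} h o (pending _ _)) snd _ with em {Sound (ρ w) o}
    ... | yes snd′ = hostile-live _
    ... | no ¬snd  = ¬snd snd

    -- Only a loss of soundness leads to `idle`, and the play is sound throughout.
    live : ∀ n → Live (hostility n)
    live zero    = hostile-live ¬ach
    live (suc n) = successor-live (pos n) (obl-sound n) (live n)

    ¬accepting : ∀ n → ¬ Accepting (obl n)
    ¬accepting n acc = go (pos n) refl (live n) acc
      where
      go : ∀ p → pos n ≡ p → Live (Position.hostility p) → ¬ Accepting (Position.obl p)
      go (position h o (bad b))          eq _ _   = ¬bad n b eq
      go (position h o (pending ¬acc _)) eq _ acc = ¬acc acc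

    -- Acceptance persists, so at a late enough time all components are accepting at once, which no
    -- live position allows.
    absurd : ⊥
    absurd = let n , accs = all-accepted o₀ id in
      ¬accepting n (subst Accepting (sym (obl-status n)) (Allₚ.map⁺ (accs n ≤-refl)))

  enforces⇒achievable : ∀ {o s} → ∃[ Σ₀ ] Enforces Σ₀ o s → Achievable o s
  enforces⇒achievable (Σ₀ , enforces) = stable (Refute.absurd Σ₀ enforces)

-- Finite enumerations.

Listed : Set → Set
Listed A = Σ[ xs ∈ List A ] (∀ x → x ∈ xs)

listed-Vec : ∀ {A} → Listed A → ∀ n → Listed (Vec A n)
listed-Vec (xs , ∈xs) zero    = [] ∷ [] , λ { [] → here refl }
listed-Vec (xs , ∈xs) (suc n) = let ys , ∈ys = listed-Vec (xs , ∈xs) n in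
  cartesianProductWith _∷_ xs ys , λ { (v ∷ vs) → ∈-cartesianProductWith⁺ _∷_ (∈xs v) (∈ys vs) }

listed-Bool : Listed Bool
listed-Bool = false ∷ true ∷ [] , λ { false → here refl ; true → there (here refl) }

singleton⇔ : ∀ {A : Set} {P : A → Set} {x} → All P (x ∷ []) ⇔ P x
singleton⇔ = mk⇔ Allₚ.singleton⁻ (_∷ [])

-- Path formulas as obligations.

module Translation (em : ExcludedMiddle 0ℓ) (k : ℕ) (AP : Set) where

  open Monitor em k AP

  subsets : List (Subset k)
  subsets = proj₁ (listed-Vec listed-Bool k)

  -- With `φ` as both hold and goal, the delayed monitor for `X φ` must see `φ` at time 1. For `G φ`
  -- the goal is unsatisfiable, so the weak until never releases `φ`.
  pathObligation : Subset k → PathFormula k AP → Obligation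
  pathObligation C (X φ)    = (component C false φ φ , waiting) ∷ []
  pathObligation C (φ U ψ)  = (component C false φ ψ , active) ∷ []
  pathObligation C (G φ)    = (component C true φ (¬ᶠ ⊤ᶠ) , active) ∷ []
  pathObligation C (θ ∧ᵖ η) = pathObligation C θ ++ pathObligation C η

  obligation : (Subset k → PathFormula k AP) → Obligation
  obligation γ = concatMap (λ C → pathObligation C (γ C)) subsets

  infix 4 _⊪_
  _⊪_ : (ℕ → Truth) → PathFormula k AP → Set
  r ⊪ (X φ)    = r 1 φ
  r ⊪ (φ U ψ)  = ∃[ i ] r i ψ × (∀ j → j < i → r j φ)
  r ⊪ (G φ)    = ∀ i → r i φ
  r ⊪ (θ ∧ᵖ η) = (r ⊪ θ) × (r ⊪ η)

  module _ (r : ℕ → Truth) where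

    Reached : Comp → ℕ → Set
    Reached c n = ∃[ i ] i < n × r i (goal c) × (∀ j → j < i → ¬ r j (goal c))

    run-active : ∀ c n →
      (run r c active n ≡ active × (∀ j → j < n → ¬ r j (goal c))) ⊎
      (run r c active n ≡ done × Reached c n)
    run-active c zero = inj₁ (refl , λ _ ())
    run-active c (suc n) with run-active c n
    ... | inj₂ (≡done , i , i<n , gi , ¬g) rewrite ≡done =
      inj₂ (refl , i , m≤n⇒m≤1+n i<n , gi , ¬g)
    ... | inj₁ (≡active , ¬g) rewrite ≡active with em {r n (goal c)}
    ...   | yes g = inj₂ (refl , n , ≤-refl , g , ¬g)
    ...   | no ¬gn = inj₁ (refl , λ j j<1+n → [ ¬g j , (λ { refl → ¬gn }) ]′ (m≤n⇒m<n∨m≡n (≤-pred j<1+n)))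

    run-waiting : ∀ c n → r 1 (goal c) → run r c waiting (2 + n) ≡ done
    run-waiting c zero g with em {r 1 (goal c)}
    ... | yes _ = refl
    ... | no ¬g = contradiction g ¬g
    run-waiting c (suc n) g rewrite run-waiting c n g = refl

    satisfied-X : ∀ C φ → Satisfied r (component C false φ φ , waiting) ⇔ r 1 φ
    satisfied-X C φ = mk⇔ (λ (snd , _) → [ id , id ]′ (snd 1)) λ r₁ →
      (λ { 0 → tt ; 1 → inj₁ r₁
         ; (suc (suc n)) → subst (λ x → Sound₁ (r (2 + n)) (c , x)) (sym (run-waiting c n r₁)) tt }) ,
      -- The monitor wakes at time 1, meets its goal there, and is `done` at time 2.
      2 , subst (λ x → Accepting₁ (c , x)) (sym (run-waiting c 0 r₁)) tt
      where c = component C false φ φ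

    satisfied-U : ∀ C φ ψ → Satisfied r (component C false φ ψ , active) ⇔ (r ⊪ (φ U ψ))
    satisfied-U C φ ψ = mk⇔ to from
      where
      c = component C false φ ψ

      to : Satisfied r (c , active) → r ⊪ (φ U ψ)
      to (snd , n , acc) with run-active c n
      ... | inj₁ (≡active , _) = case subst (λ x → Accepting₁ (c , x)) ≡active acc of λ ()
      ... | inj₂ (_ , i , _ , gi , ¬g) = i , gi , hold-before
        where
        hold-before : ∀ j → j < i → r j φ
        hold-before j j<i with run-active c j
        ... | inj₁ (≡active , _) = [ id , ⊥-elim ∘ ¬g j j<i ]′ (subst (λ x → Sound₁ (r j) (c , x)) ≡active (snd j))
        ... | inj₂ (_ , m , m<j , gm , _) = contradiction gm (¬g m (<-trans m<j j<i))

      from : r ⊪ (φ U ψ) → Satisfied r (c , active)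
      -- A goal met at time `i` shows in the status one step later.
      from (i , gi , hj) = sound , suc i , accepted
        where
        sound : ∀ n → Sound₁ (r n) (c , run r c active n)
        sound n with run-active c n
        ... | inj₂ (≡done , _) rewrite ≡done = tt
        ... | inj₁ (≡active , ¬g) rewrite ≡active with <-cmp n i
        ...   | tri< n<i _ _  = inj₁ (hj n n<i)
        ...   | tri≈ _ refl _ = inj₂ gi
        ...   | tri> _ _ i<n  = contradiction gi (¬g i i<n)

        accepted : Accepting₁ (c , run r c active (suc i))
        accepted with run-active c (suc i)
        ... | inj₁ (_ , ¬g) = contradiction gi (¬g i ≤-refl)
        ... | inj₂ (≡done , _) = subst (λ x → Accepting₁ (c , x)) (sym ≡done) tt

    -- Here `r` is an arbitrary assignment of truth values, so falsity of `¬ᶠ ⊤ᶠ` has to be assumed.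
    satisfied-G : (∀ n → ¬ r n (¬ᶠ ⊤ᶠ)) → ∀ C φ →
      Satisfied r (component C true φ (¬ᶠ ⊤ᶠ) , active) ⇔ (r ⊪ (G φ))
    satisfied-G ¬⊥ C φ = mk⇔
      (λ (snd , _) n → [ id , ⊥-elim ∘ ¬⊥ n ]′ (subst (λ x → Sound₁ (r n) (c , x)) (always n) (snd n)))
      (λ h → (λ n → subst (λ x → Sound₁ (r n) (c , x)) (sym (always n)) (inj₁ (h n))) , 0 , refl)
      where
      c = component C true φ (¬ᶠ ⊤ᶠ)

      always : ∀ n → run r c active n ≡ active
      always n with run-active c n
      ... | inj₁ (≡active , _)        = ≡active
      ... | inj₂ (_ , i , _ , gi , _) = contradiction gi (¬⊥ i)

    satisfied-path : (∀ n → ¬ r n (¬ᶠ ⊤ᶠ)) → ∀ C θ →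
      All (Satisfied r) (pathObligation C θ) ⇔ (r ⊪ θ)
    satisfied-path ¬⊥ C (X φ)    = satisfied-X C φ ⇔-∘ singleton⇔
    satisfied-path ¬⊥ C (φ U ψ)  = satisfied-U C φ ψ ⇔-∘ singleton⇔
    satisfied-path ¬⊥ C (G φ)    = satisfied-G ¬⊥ C φ ⇔-∘ singleton⇔
    satisfied-path ¬⊥ C (θ ∧ᵖ η) = (satisfied-path ¬⊥ C θ ×-⇔ satisfied-path ¬⊥ C η) ⇔-∘
      mk⇔ (Allₚ.++⁻ (pathObligation C θ)) (λ (x , y) → Allₚ.++⁺ x y)

  pathObligation-coal : ∀ C θ {c st} → (c , st) ∈ pathObligation C θ → coal c ≡ C
  pathObligation-coal C (X φ)    (here refl) = refl
  pathObligation-coal C (φ U ψ)  (here refl) = refl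
  pathObligation-coal C (G φ)    (here refl) = refl
  pathObligation-coal C (θ ∧ᵖ η) c∈ =
    [ pathObligation-coal C θ , pathObligation-coal C η ]′ (∈-++⁻ (pathObligation C θ) c∈)

  module _ (M : Model k AP) (ρ : Model.State M → Truth) (¬⊥ : ∀ w → ¬ ρ w (¬ᶠ ⊤ᶠ)) where

    open Fixpoints em M ρ

    enforces⇔ : ∀ Σ₀ γ s → Enforces Σ₀ (obligation γ) s ⇔ (∀ C π → paths s Σ₀ C π → (ρ ∘ π) ⊪ γ C)
    enforces⇔ Σ₀ γ s = mk⇔
      (λ enf C π π∈ → Equivalence.to (satisfied-path (ρ ∘ π) (¬⊥ ∘ π) C (γ C)) (All.tabulate λ {(c , st)} c∈ →
        enf {c} {st} (∈-concatMap⁺ (λ C → pathObligation C (γ C)) (lose (proj₂ (listed-Vec listed-Bool k) C) c∈)) π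
          (subst (λ C → paths s Σ₀ C π) (sym (pathObligation-coal C (γ C) c∈)) π∈)))
      λ sat {c} {st} c∈ π π∈ →
        let C , _ , c∈C = find (∈-concatMap⁻ (λ C → pathObligation C (γ C)) {xs = subsets} c∈) in
        All.lookup (Equivalence.from (satisfied-path (ρ ∘ π) (¬⊥ ∘ π) C (γ C))
          (sat C π (subst (λ C → paths s Σ₀ C π) (pathObligation-coal C (γ C) c∈C) π∈))) c∈C

    strategic : ∀ γ s → (Σ[ Σ₀ ∈ StrategyProfile M ] (∀ C π → paths s Σ₀ C π → (ρ ∘ π) ⊪ γ C)) ⇔
      Achievable (obligation γ) s
    strategic γ s = mk⇔
      (λ (Σ₀ , sat) → Adversary.enforces⇒achievable em M ρ (Σ₀ , Equivalence.from (enforces⇔ Σ₀ γ s) sat))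
      (λ ach → Follow.strategy ach , Equivalence.to (enforces⇔ _ γ s) (Follow.enforces ach))

-- A measure that decreases whenever an obligation changes.

module Progress (em : ExcludedMiddle 0ℓ) (k : ℕ) (AP : Set) where

  open Monitor em k AP

  rank : Status → ℕ
  rank waiting = 2
  rank active  = 1
  rank done    = 0

  size : Obligation → ℕ
  size o = sum (List.map (rank ∘ proj₂) o)

  advance-rank : ∀ ρ c s → advance ρ c s ≡ s ⊎ rank (advance ρ c s) < rank s
  advance-rank ρ c waiting = inj₂ ≤-refl
  advance-rank ρ c done    = inj₁ refl
  advance-rank ρ c active with does (em {ρ (goal c)})
  ... | true  = inj₂ ≤-refl
  ... | false = inj₁ refl

  next₁-rank : ∀ ρ A c s → next₁ ρ A c s ≡ s ⊎ rank (next₁ ρ A c s) < rank s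
  next₁-rank ρ A c s with does (coal c ⊆? A)
  ... | true = advance-rank ρ c s
  next₁-rank ρ A c waiting | false = inj₂ (s≤s z≤n)
  next₁-rank ρ A c active  | false = inj₂ (s≤s z≤n)
  next₁-rank ρ A c done    | false = inj₁ refl

  -- Statuses only move towards `done`, so every change lowers the total rank.
  next-size : ∀ ρ A o → next ρ A o ≡ o ⊎ size (next ρ A o) < size o
  next-size ρ A [] = inj₁ refl
  next-size ρ A ((c , s) ∷ o) with next₁-rank ρ A c s | next-size ρ A o
  ... | inj₁ e | inj₁ e′ = inj₁ (cong₂ (λ x y → (c , x) ∷ y) e e′)
  ... | inj₁ e | inj₂ q rewrite e = inj₂ (+-monoʳ-< (rank s) q)
  ... | inj₂ p | inj₁ e′ rewrite e′ = inj₂ (+-monoˡ-< _ p)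
  ... | inj₂ p | inj₂ q = inj₂ (+-mono-< p q)

  next-size-< : ∀ ρ A o → next ρ A o ≢ o → size (next ρ A o) < size o
  next-size-< ρ A o ≢o = [ (λ e → contradiction e ≢o) , id ]′ (next-size ρ A o)

  next₁-stable-⊆ : ∀ ρ {A B} → A ⊆ B → ∀ c s → next₁ ρ A c s ≡ s → next₁ ρ B c s ≡ s
  next₁-stable-⊆ ρ {A} {B} A⊆B c s e with coal c ⊆? A | coal c ⊆? B
  ... | yes _   | yes _   = e
  ... | yes C⊆A | no C⊈B = contradiction (λ {x} x∈ → A⊆B (C⊆A x∈)) C⊈B
  ... | no _    | no _    = e
  next₁-stable-⊆ ρ A⊆B c done e | no _ | yes _ = refl

  -- A larger loyal set discharges fewer components, and a component that the smaller set discharges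
  -- without change was already `done`.
  next-stable-⊆ : ∀ ρ {A B} → A ⊆ B → ∀ o → next ρ A o ≡ o → next ρ B o ≡ o
  next-stable-⊆ ρ A⊆B [] e = refl
  next-stable-⊆ ρ A⊆B ((c , s) ∷ o) e = cong₂ (λ x y → (c , x) ∷ y)
    (next₁-stable-⊆ ρ A⊆B c s (cong proj₂ (Listₚ.∷-injectiveˡ e)))
    (next-stable-⊆ ρ A⊆B o (Listₚ.∷-injectiveʳ e))

  components : Obligation → List Comp
  components = List.map proj₁

  components-next : ∀ ρ A o → components (next ρ A o) ≡ components o
  components-next ρ A o = sym (Listₚ.map-∘ o)

  statuses : List Status
  statuses = waiting ∷ active ∷ done ∷ []

  ∈-statuses : ∀ s → s ∈ statuses
  ∈-statuses waiting = here refl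
  ∈-statuses active  = there (here refl)
  ∈-statuses done    = there (there (here refl))

  obligations : List Comp → List Obligation
  obligations []       = [] ∷ []
  obligations (c ∷ cs) = cartesianProductWith (λ s o → (c , s) ∷ o) statuses (obligations cs)

  ∈-obligations : ∀ o → o ∈ obligations (components o)
  ∈-obligations []            = here refl
  ∈-obligations ((c , s) ∷ o) = ∈-cartesianProductWith⁺ (λ s o → (c , s) ∷ o) (∈-statuses s) (∈-obligations o)

-- Types of states and the local voting game.

module Local (em : ExcludedMiddle 0ℓ) {k : ℕ} {AP : Set} (M : Model k AP)
  (ρ : Model.State M → StateFormula k AP → Set) (css : List (List (Component k AP))) where

  open Model M
  open Monitor em k AP
  open Progress em k AP
  open Fixpoints em M ρ

  Relevant : Obligation → Set
  Relevant o = components o ∈ css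

  next-relevant : ∀ ρ A {o} → Relevant o → Relevant (next ρ A o)
  next-relevant ρ A {o} = subst (_∈ css) (sym (components-next ρ A o))

  abstract
    relevant : List Obligation
    relevant = concatMap obligations css

    ∈-relevant : ∀ {o} → Relevant o → o ∈ relevant
    ∈-relevant {o} o∈ = ∈-concatMap⁺ obligations (lose o∈ (∈-obligations o))

  Label : Set
  Label = Vec Bool (List.length relevant)

  abstract
    labels : Listed Label
    labels = listed-Vec listed-Bool _

    type : State → Label
    type w = Vec.tabulate (λ i → does (em {Achievable (List.lookup relevant i) w}))

    type-achievable : ∀ {u w o} → type u ≡ type w → Relevant o → Achievable o u → Achievable o w
    type-achievable {u} {w} {o} e rel ach = subst (λ o → Achievable o w) (sym o≡)
      (does⇒ (trans (sym (bit w)) (trans (cong (λ t → Vec.lookup t i) (sym e))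
        (trans (bit u) (dec-true em (subst (λ o → Achievable o u) o≡ ach))))))
      where
      i : Fin (List.length relevant)
      i = index (∈-relevant rel)

      o≡ : o ≡ List.lookup relevant i
      o≡ = lookup-index (∈-relevant rel)

      bit : ∀ w → Vec.lookup (type w) i ≡ does (em {Achievable (List.lookup relevant i) w})
      bit w = Vecₚ.lookup∘tabulate _ i

      does⇒ : ∀ {P : Set} → does (em {P}) ≡ true → P
      does⇒ {P} e with em {P}
      ... | yes p = p

  -- In the finite models, an agent either plays its part of a profile chosen
  -- for an obligation, or votes for the type of the successor state.
  abstract
    acts : List (Obligation ⊎ Label)
    acts = List.map inj₁ relevant ++ List.map inj₂ (proj₁ labels)

    ∈-acts-pursue : ∀ {o} → Relevant o → inj₁ o ∈ acts
    ∈-acts-pursue rel = ∈-++⁺ˡ (∈-map⁺ inj₁ (∈-relevant rel))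

    ∈-acts-elect : ∀ l → inj₂ l ∈ acts
    ∈-acts-elect l = ∈-++⁺ʳ (List.map inj₁ relevant) (∈-map⁺ inj₂ (proj₂ labels l))

  Code : Set
  Code = Fin (List.length acts)

  decode : Code → Obligation ⊎ Label
  decode = List.lookup acts

  pursue : ∀ {o} → Relevant o → Σ[ x ∈ Code ] decode x ≡ inj₁ o
  pursue rel = index (∈-acts-pursue rel) , sym (lookup-index (∈-acts-pursue rel))

  elect : ∀ l → Σ[ x ∈ Code ] decode x ≡ inj₂ l
  elect l = index (∈-acts-elect l) , sym (lookup-index (∈-acts-elect l))

  infixr 5 _⊕_
  -- Bitwise exclusive or makes the labels a group in which each element is its own inverse, so any
  -- single vote can set the sum to any label.
  _⊕_ : Label → Label → Label
  _⊕_ = Vec.zipWith _xor_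

  ⊕-cancelˡ : ∀ l m → l ⊕ l ⊕ m ≡ m
  ⊕-cancelˡ l m = trans (sym (Vecₚ.zipWith-assoc xor-assoc l l m))
    (trans (cong (_⊕ m) (trans (cong (_⊕ l) (sym (Vecₚ.map-id l))) (Vecₚ.zipWith-inverseˡ {⁻¹ = id} xor-same l)))
      (Vecₚ.zipWith-identityˡ xor-identityˡ m))

  ⊕-cancelʳ : ∀ l m → (l ⊕ m) ⊕ m ≡ l
  ⊕-cancelʳ l m = trans (Vecₚ.zipWith-comm xor-comm (l ⊕ m) m)
    (trans (cong (m ⊕_) (Vecₚ.zipWith-comm xor-comm l m)) (⊕-cancelˡ m l))

  -- A pursuing agent contributes the neutral element.
  vote : Code → Label
  vote x = [ (λ _ → Vec.replicate _ false) , id ]′ (decode x)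

  total : ∀ {n} → Vec Code n → Label
  total = Vec.foldr′ (λ x l → vote x ⊕ l) (Vec.replicate _ false)

  steer : ∀ {n} (v : Vec Code n) b l →
    Σ[ x ∈ Code ] total (v Vec.[ b ]≔ x) ≡ l × (∃[ m ] decode x ≡ inj₂ m)
  steer (y ∷ v) zero    l = let x , x≡ = elect (l ⊕ total v) in
    x , trans (cong (λ z → [ _ , id ]′ z ⊕ total v) x≡) (⊕-cancelʳ l (total v)) , _ , x≡
  steer (y ∷ v) (suc b) l = let x , x≡ , m = steer v b (vote y ⊕ l) in
    x , trans (cong (vote y ⊕_) x≡) (⊕-cancelˡ (vote y) l) , m

  Joint : Set
  Joint = Vec Code k

  Agreeᶜ : Subset k → Joint → Joint → Set
  Agreeᶜ A v v′ = ∀ a → a ∈ₛ A → Vec.lookup v a ≡ Vec.lookup v′ a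

  abstract
    -- All agents outside `A` are turned into voters, so that `Fits` constrains only agents in `A`;
    -- then `b` adjusts its vote to correct the sum.
    redirect : ∀ v A {b} → ¬ (b ∈ₛ A) → ∀ l → Σ[ v′ ∈ Joint ]
      Agreeᶜ A v v′ × total v′ ≡ l × (∀ a → ¬ (a ∈ₛ A) → ∃[ m ] decode (Vec.lookup v′ a) ≡ inj₂ m)
    redirect v A {b} b∉ l = v₀ Vec.[ b ]≔ x , agr , x-total , out
      where
      blank : Σ[ x ∈ Code ] decode x ≡ inj₂ l
      blank = elect l

      default : ∀ a → Dec (a ∈ₛ A) → Code
      default a (yes _) = Vec.lookup v a
      default a (no _)  = proj₁ blank

      v₀ : Joint
      v₀ = Vec.tabulate (λ a → default a (a ∈? A))

      steering : Σ[ x ∈ Code ] total (v₀ Vec.[ b ]≔ x) ≡ l × (∃[ m ] decode x ≡ inj₂ m)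
      steering = steer v₀ b l

      x : Code
      x = proj₁ steering

      x-total : total (v₀ Vec.[ b ]≔ x) ≡ l
      x-total = proj₁ (proj₂ steering)

      agr : Agreeᶜ A v (v₀ Vec.[ b ]≔ x)
      agr a a∈ = sym (trans (Vecₚ.lookup∘updateAt′ a b (λ { refl → b∉ a∈ }) v₀)
        (trans (Vecₚ.lookup∘tabulate _ a) default≡))
        where
        default≡ : default a (a ∈? A) ≡ Vec.lookup v a
        default≡ with a ∈? A
        ... | yes _  = refl
        ... | no a∉ = contradiction a∈ a∉

      out : ∀ a → ¬ (a ∈ₛ A) → ∃[ m ] decode (Vec.lookup (v₀ Vec.[ b ]≔ x) a) ≡ inj₂ m
      out a a∉ with a Fin.≟ b
      ... | yes refl rewrite Vecₚ.lookup∘update a v₀ x = proj₂ (proj₂ steering)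
      ... | no a≢b rewrite Vecₚ.lookup∘update′ a≢b v₀ x | Vecₚ.lookup∘tabulate (λ a → default a (a ∈? A)) a
          with a ∈? A
      ...   | yes a∈ = contradiction a∈ a∉
      ...   | no _   = l , proj₂ blank

  -- Among the profiles that realise a vote, one in Pref is chosen if possible:
  -- this lets the opponents descend along a given derivation of Bad.
  module Realise (w : State) (base : Obligation → Game.Profile w) (Pref : Game.Profile w → Set) where

    Fits : Joint → Game.Profile w → Set
    Fits v ζ = ∀ a o → decode (Vec.lookup v a) ≡ inj₁ o → choice w ζ a ≡ choice w (base o) a

    Matches : Joint → Game.Profile w → Set
    Matches v ζ = Fits v ζ × type (Game.out w ζ) ≡ total v

    assemble : Joint → Game.Profile w
    assemble v = Game.profile w λ a →
      [ (λ o → choice w (base o) a) , (λ _ → choice w (someProfile w) a) ]′ (decode (Vec.lookup v a))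

    assemble-fits : ∀ v → Fits v (assemble v)
    assemble-fits v a o e = trans (choice-profile w _ a)
      (cong [ (λ o → choice w (base o) a) , (λ _ → choice w (someProfile w) a) ]′ e)

    abstract
      select : ∀ v → Dec (∃[ ζ ] Matches v ζ × Pref ζ) → Dec (∃ (Matches v)) → Game.Profile w
      select v (yes (ζ , _)) _             = ζ
      select v (no _)        (yes (ζ , _)) = ζ
      select v (no _)        (no _)        = assemble v

      real : Joint → Game.Profile w
      real v = select v em em

      real-fits : ∀ v → Fits v (real v)
      real-fits v with em {∃[ ζ ] Matches v ζ × Pref ζ} | em {∃ (Matches v)}
      ... | yes (_ , (fits , _) , _) | _                  = fits
      ... | no _                     | yes (_ , fits , _) = fits
      ... | no _                     | no _               = assemble-fits v

      real-type : ∀ v {ζ} → Matches v ζ → type (Game.out w (real v)) ≡ total v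
      real-type v {ζ} m with em {∃[ ζ ] Matches v ζ × Pref ζ} | em {∃ (Matches v)}
      ... | yes (_ , (_ , ≡total) , _) | _                    = ≡total
      ... | no _                       | yes (_ , _ , ≡total) = ≡total
      ... | no _                       | no ¬m                = contradiction (ζ , m) ¬m

      real-pref : ∀ v {ζ} → Matches v ζ → Pref ζ → Pref (real v)
      real-pref v {ζ} m p with em {∃[ ζ ] Matches v ζ × Pref ζ}
      ... | yes (_ , _ , pref) = pref
      ... | no ¬p              = contradiction (ζ , m , p) ¬p

    pursuers : Obligation → Joint → Subset k
    pursuers o v = comprehension (λ a → decode (Vec.lookup v a) ≡ inj₁ o)

    pursuers-agree : ∀ o v → Agree w (pursuers o v) (base o) (real v)
    pursuers-agree o v a a∈ = sym (real-fits v a o (∈-comprehension⁻ a∈))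

    ⊆-pursuers : ∀ {o} (rel : Relevant o) v {A} →
      Agreeᶜ A (Vec.replicate k (proj₁ (pursue rel))) v → A ⊆ pursuers o v
    ⊆-pursuers rel v agr {a} a∈ = ∈-comprehension⁺ (trans
      (cong decode (trans (sym (agr a a∈)) (Vecₚ.lookup-replicate a _))) (proj₂ (pursue rel)))

    -- Some agent outside A can swing the vote to the type of the successor
    -- under ζ; the profile realising the vote need not agree with real v on A.
    imitate : ∀ v ζ A → Agree w A (real v) ζ → Σ[ v′ ∈ Joint ]
      Agreeᶜ A v v′ × type (Game.out w (real v′)) ≡ type (Game.out w ζ) × (Pref ζ → Pref (real v′))
    imitate v ζ A agr with Fin.all? (λ a → a ∈? A)
    ... | yes all = v , (λ _ _ → refl) , cong (type ∘ Game.out w) real≡ , subst Pref (sym real≡)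
      where
      real≡ : real v ≡ ζ
      real≡ = choice-injective w (λ a → agr a (all a))
    ... | no ¬all with Fin.¬∀⟶∃¬ k _ (λ a → a ∈? A) ¬all
    ...   | b , b∉ with redirect v A b∉ (type (Game.out w ζ))
    ...     | v′ , agrᶜ , ≡total , out = v′ , agrᶜ , trans (real-type v′ matches) ≡total , real-pref v′ matches
      where
      fits : Fits v′ ζ
      fits a o e with a ∈? A
      ... | yes a∈ = trans (sym (agr a a∈)) (real-fits v a o (trans (cong decode (agrᶜ a a∈)) e))
      ... | no a∉  = case trans (sym e) (proj₂ (out a a∉)) of λ ()

      matches : Matches v′ ζ
      matches = fits , sym ≡total

-- Well-founded trees of local games.

module Trees (em : ExcludedMiddle 0ℓ) {k : ℕ} {AP : Set} (M : Model k AP)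
  (ρ : Model.State M → StateFormula k AP → Set) (css : List (List (Component k AP))) where

  open Model M
  open Monitor em k AP
  open Progress em k AP
  open Fixpoints em M ρ
  open Local em M ρ css

  -- The local game preserves one step of achieving and one step of opposing; nothing is said yet
  -- about fixed points.
  record Faithful (w : State) (real : Joint → Game.Profile w) : Set where
    field
      achieve : ∀ {o} → Relevant o → Achievable o w → Σ[ v ∈ Joint ] (∀ v′ A → Agreeᶜ A v v′ →
        Achievable (next (ρ w) A o) (Game.out w (real v′)))
      oppose  : ∀ {o} → Relevant o → Sound (ρ w) o → ¬ Achievable o w →
        ∀ v → Σ[ v′ ∈ Joint ] Σ[ A ∈ Subset k ]
          Agreeᶜ A v v′ × ¬ Achievable (next (ρ w) A o) (Game.out w (real v′))

  Serves : ∀ w → Obligation → Game.Profile w → Set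
  Serves w o ζ = ∀ ζ′ A → Agree w A ζ ζ′ → Achievable (next (ρ w) A o) (Game.out w ζ′)

  module _ {w} (base : Obligation → Game.Profile w) (Pref : Game.Profile w → Set)
    (serves : ∀ o → Achievable o w → Serves w o (base o)) where

    open Realise w base Pref

    -- To achieve `o`, all agents pursue it, and those who stick to this follow `base o`. To oppose
    -- it, `imitate` turns a reply in the real game into votes with the same successor type.
    faithful : Faithful w real
    faithful = record
      { achieve = λ {o} rel ach → Vec.replicate k (proj₁ (pursue rel)) , λ v′ A agr →
          serves o ach (real v′) A λ a a∈ → pursuers-agree o v′ a (⊆-pursuers rel v′ agr a∈)
      ; oppose = λ {o} rel snd ¬ach v →
          let ζ , A , agr , ¬ach′ = ¬achievable⇒reply ¬ach snd (real v)
              v′ , agrᶜ , ≡type , _ = imitate v ζ A agr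
          in v′ , A , agrᶜ , λ ach → ¬ach′ (type-achievable ≡type (next-relevant (ρ w) A rel) ach)
      }

  base₀ : ∀ w o → Dec (Achievable o w) → Game.Profile w
  base₀ w o (yes ach) = proj₁ (proj₂ (achievable⇒move ach))
  base₀ w o (no _)    = someProfile w

  base₀-serves : ∀ w o → Achievable o w → Serves w o (base₀ w o em)
  base₀-serves w o ach with em {Achievable o w}
  ... | yes ach′ = proj₂ (proj₂ (achievable⇒move ach′))
  ... | no ¬ach  = contradiction ach ¬ach

  -- A missing child marks a move by which the play leaves the tree.
  data Tree (w : State) : Set where
    node : (real : Joint → Game.Profile w) → Faithful w real →
           (∀ v → Maybe (Tree (Game.out w (real v)))) → Tree w

  abstract
    bare : ∀ w → Tree w
    bare w = node _ (faithful (λ o → base₀ w o em) (λ _ → ⊥) (base₀-serves w)) (λ _ → nothing)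

  -- The tree pursues o as long as o stays the same.
  data Pursues (o : Obligation) {w : State} : Tree w → Set where
    pursues : ∀ {real faith child} → Sound (ρ w) o → (v : Joint) →
      (∀ v′ A → Agreeᶜ A v v′ → Achievable (next (ρ w) A o) (Game.out w (real v′))) →
      (∀ v′ A → Agreeᶜ A v v′ → next (ρ w) A o ≡ o → Any (Pursues o) (child v′)) →
      Pursues o (node real faith child)

  -- The dual of `Pursues`: the opponents head for a loss of soundness inside the tree while `o`
  -- stays the same.
  data Thwarts (o : Obligation) {w : State} : Tree w → Set where
    unsound : ∀ {τ} → ¬ Sound (ρ w) o → Thwarts o τ
    thwarts : ∀ {real faith child} (reply : Joint → Joint) (A : Joint → Subset k) →
      (∀ v → Agreeᶜ (A v) v (reply v)) →
      (∀ v → ¬ Achievable (next (ρ w) (A v) o) (Game.out w (real (reply v)))) →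
      (∀ v → next (ρ w) (A v) o ≡ o → Any (Thwarts o) (child (reply v))) →
      Thwarts o (node real faith child)

  -- The tree copies the derivation, with children where the pursuers leave `o` unchanged. The
  -- separate `o′` lets the recursion pass to subderivations for obligations that merely equal `o`.
  pursuit : ∀ {o o′ w} → Achievable o′ w → o′ ≡ o → Relevant o → ¬ Accepting o → Σ (Tree w) (Pursues o)
  pursuit (now acc _) refl rel ¬acc = contradiction acc ¬acc
  pursuit {o} {w = w} (later snd ζ f) refl rel ¬acc = node real faith child ,
    pursues snd (Vec.replicate k (proj₁ (pursue rel)))
      (λ v′ A agr → f (real v′) A λ a a∈ → follows v′ a (⊆-pursuers rel v′ agr a∈)) λ v′ A agr →
      grow-pursues v′ em ∘ next-stable-⊆ (ρ w) (⊆-pursuers rel v′ agr) o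
    where
    base : ∀ o′ → Dec (o′ ≡ o) → Game.Profile w
    -- For `o` itself the profile of this very derivation is used, so that its successors come with
    -- subderivations.
    base o′ (yes _) = ζ
    base o′ (no _)  = base₀ w o′ em

    serves : ∀ o′ → Achievable o′ w → Serves w o′ (base o′ em)
    serves o′ ach with em {o′ ≡ o}
    ... | yes refl = f
    ... | no _     = base₀-serves w o′ ach

    base-o : base o em ≡ ζ
    base-o with em {o ≡ o}
    ... | yes _  = refl
    ... | no o≢o = contradiction refl o≢o

    open Realise w (λ o′ → base o′ em) (λ _ → ⊥)

    faith : Faithful w real
    faith = faithful _ _ serves

    follows : ∀ v → Agree w (pursuers o v) ζ (real v)
    follows v a a∈ = trans (cong (λ ζ → choice w ζ a) (sym base-o)) (pursuers-agree o v a a∈)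

    grow : ∀ v → Dec (next (ρ w) (pursuers o v) o ≡ o) →
      Maybe (Σ (Tree (Game.out w (real v))) (Pursues o))
    grow v (yes e) = just (pursuit (f (real v) (pursuers o v) (follows v)) e rel ¬acc)
    grow v (no _)  = nothing

    child : ∀ v → Maybe (Tree (Game.out w (real v)))
    child v = Maybe.map proj₁ (grow v em)

    grow-pursues : ∀ v (e? : Dec (next (ρ w) (pursuers o v) o ≡ o)) → next (ρ w) (pursuers o v) o ≡ o →
      Any (Pursues o) (Maybe.map proj₁ (grow v e?))
    grow-pursues v (yes e) _ = just (proj₂ (pursuit (f (real v) (pursuers o v) (follows v)) e rel ¬acc))
    grow-pursues v (no ≢)  e = contradiction e ≢

  -- The profile realising the opponents' votes need not be the intended reply. Preferring profiles
  -- in `Pref` ensures that it is a reply for some `ζ` that leaves `o` unchanged, hence has a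
  -- subderivation.
  thwarting : ∀ {o o′ w} → Bad o′ w → o′ ≡ o → Relevant o → Accepting o → Σ (Tree w) (Thwarts o)
  thwarting {w = w} (fail ¬snd) refl rel acc = bare w , unsound ¬snd
  thwarting {o} {w = w} (force reply A agr sub) refl rel acc = node real faith child ,
    thwarts (λ v → proj₁ (response v)) (A ∘ real) (λ v → proj₁ (proj₂ (response v)))
      (λ v ach → achievable⇒¬bad (next-accepting (ρ w) (A (real v)) acc)
        (type-achievable (proj₁ (proj₂ (proj₂ (response v)))) (next-relevant (ρ w) (A (real v)) rel) ach)
        (sub (real v)))
      λ v e → grow-thwarts em (proj₂ (proj₂ (proj₂ (response v))) (real v , refl , e))
    where
    Pref : Game.Profile w → Set
    Pref ζ′ = Σ[ ζ ∈ Game.Profile w ] reply ζ ≡ ζ′ × next (ρ w) (A ζ) o ≡ o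

    open Realise w (λ o′ → base₀ w o′ em) Pref

    faith : Faithful w real
    faith = faithful _ _ (base₀-serves w)

    response : ∀ v → Σ[ v′ ∈ Joint ] Agreeᶜ (A (real v)) v v′ ×
      type (Game.out w (real v′)) ≡ type (Game.out w (reply (real v))) × (Pref (reply (real v)) → Pref (real v′))
    response v = imitate v (reply (real v)) (A (real v)) (agr (real v))

    grow : ∀ {ζ′} → Dec (Pref ζ′) → Maybe (Σ (Tree (Game.out w ζ′)) (Thwarts o))
    grow (yes (ζ , refl , e)) = just (thwarting (sub ζ) e rel acc)
    grow (no _)               = nothing

    child : ∀ v → Maybe (Tree (Game.out w (real v)))
    child v = Maybe.map proj₁ (grow em)

    grow-thwarts : ∀ {ζ′} (p? : Dec (Pref ζ′)) → Pref ζ′ → Any (Thwarts o) (Maybe.map proj₁ (grow p?))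
    grow-thwarts (yes (ζ , refl , e)) p = just (proj₂ (thwarting (sub ζ) e rel acc))
    grow-thwarts (no ¬p)              p = contradiction p ¬p

-- Cyclic composition of the trees.

module Unfolding (em : ExcludedMiddle 0ℓ) {k : ℕ} {AP : Set} (M : Model k AP)
  (ρ : Model.State M → StateFormula k AP → Set) (css : List (List (Component k AP)))
  (s₀ : Model.State M) where

  open Model M
  open Monitor em k AP
  open Progress em k AP
  open Fixpoints em M ρ
  open Local em M ρ css
  open Trees em M ρ css

  abstract
    -- Depth is needed only where a least fixed point must be rebuilt: `Achievable` when `o` is not
    -- accepting, `Bad` when it is. In the other two cases the faithfulness of each single node
    -- suffices.
    cultivate : ∀ o w → Σ[ τ ∈ Tree w ]
      (Relevant o → Accepting o → ¬ Achievable o w → Thwarts o τ) ×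
      (Relevant o → ¬ Accepting o → Achievable o w → Pursues o τ)
    cultivate o w with em {Relevant o} | em {Accepting o} | em {Achievable o w}
    ... | no ¬rel | _       | _       =
      bare w , (λ rel → contradiction rel ¬rel) , λ rel → contradiction rel ¬rel
    ... | yes rel | yes acc | yes ach =
      bare w , (λ _ _ ¬ach → contradiction ach ¬ach) , λ _ ¬acc → contradiction acc ¬acc
    ... | yes rel | no ¬acc | no ¬ach =
      bare w , (λ _ acc → contradiction acc ¬acc) , λ _ _ ach → contradiction ach ¬ach
    ... | yes rel | yes acc | no ¬ach =
      let τ , t = thwarting (¬achievable⇒bad acc ¬ach) refl rel acc in
      τ , (λ _ _ _ → t) , λ _ ¬acc → contradiction acc ¬acc
    ... | yes rel | no ¬acc | yes ach =
      let τ , p = pursuit ach refl rel ¬acc in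
      τ , (λ _ acc → contradiction acc ¬acc) , λ _ _ _ → p

  tree : List Obligation → ∀ w → Tree w
  tree []      w = bare w
  tree (o ∷ _) w = proj₁ (cultivate o w)

  -- A position in one of the trees.  The head of the list is the obligation
  -- that the tree serves, the tail lists those whose turn comes next.
  Spot : Set
  Spot = List Obligation × Σ State Tree

  value : Spot → State
  value (_ , w , _) = w

  after : List Obligation → List Obligation
  after []      = relevant
  after (_ ∷ l) = l

  abstract
    represent : ∀ t → Dec (∃[ w ] type w ≡ t) → State
    represent t (yes (w , _)) = w
    -- Labels that are the type of no state get `s₀` as a default.
    represent t (no _)        = s₀

    representative : Label → State
    representative t = represent t em

    representative-type : ∀ w → type (representative (type w)) ≡ type w
    representative-type w with em {∃[ u ] type u ≡ type w}
    ... | yes (_ , e) = e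
    ... | no ¬∃       = contradiction (w , refl) ¬∃

  root : List Obligation → Label → Spot
  root l t = l , representative t , tree l (representative t)

  continue : List Obligation → ∀ {w} → Maybe (Tree w) → Spot
  continue l (just τ)    = l , _ , τ
  continue l {w} nothing = root (after l) (type w)

  continue-type : ∀ l {w} (τ? : Maybe (Tree w)) → type (value (continue l τ?)) ≡ type w
  continue-type l (just _)    = refl
  continue-type l {w} nothing = representative-type w

  move : Spot → Joint → Spot
  move (l , w , node real faith child) v = continue l (child v)

  achieve : ∀ x {o} → Relevant o → Achievable o (value x) → Σ[ v ∈ Joint ] (∀ v′ A → Agreeᶜ A v v′ →
    Achievable (next (ρ (value x)) A o) (value (move x v′)))
  achieve (l , w , node real faith child) rel ach =
    let v , f = Faithful.achieve faith rel ach in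
    v , λ v′ A agr → type-achievable (sym (continue-type l (child v′))) (next-relevant (ρ w) A rel) (f v′ A agr)

  oppose : ∀ x {o} → Relevant o → Sound (ρ (value x)) o → ¬ Achievable o (value x) →
    ∀ v → Σ[ v′ ∈ Joint ] Σ[ A ∈ Subset k ]
      Agreeᶜ A v v′ × ¬ Achievable (next (ρ (value x)) A o) (value (move x v′))
  oppose (l , w , node real faith child) rel snd ¬ach v =
    let v′ , A , agr , ¬ach′ = Faithful.oppose faith rel snd ¬ach v in
    v′ , A , agr , λ ach → ¬ach′ (type-achievable (continue-type l (child v′)) (next-relevant (ρ w) A rel) ach)

  -- Leaving trees over and over, one eventually enters a tree that serves o.
  module Cycle {o : Obligation} (o∈ : o ∈ relevant) (K : State → Set) (Z : Spot → Set)
    (local : ∀ x → K (value x) → (∀ v → K (value (move x v)) → Z (move x v)) → Z x)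
    (target : ∀ l t → K (representative t) → Z (root (o ∷ l) t)) where

    Roots : List Obligation → Set
    Roots l = ∀ t → K (representative t) → Z (root l t)

    mutual
      -- Trees are well-founded, so each play leaves the current one; induction on the tree carries
      -- `Z` back from the roots entered next.
      inside : ∀ l → Roots (after l) → ∀ {w} (τ : Tree w) → K w → Z (l , w , τ)
      inside l roots (node real faith child) Kw =
        local (l , _ , node real faith child) Kw (λ v → beyond l roots (child v))

      beyond : ∀ l → Roots (after l) → ∀ {w} (τ? : Maybe (Tree w)) → K (value (continue l τ?)) → Z (continue l τ?)
      beyond l roots (just τ)    = inside l roots τ
      beyond l roots {w} nothing = roots (type w)

    previous : ∀ l → Roots (after l) → Roots l
    previous l roots t = inside l roots (tree l (representative t))

    roots-∈ : ∀ {l} → o ∈ l → Roots l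
    roots-∈ (here refl) = target _
    roots-∈ (there o∈l) = previous _ (roots-∈ o∈l)

    -- The rest of the current round may lack `o`, so `l` is run down to `[]`, after which a full
    -- round through `relevant` begins.
    roots : ∀ l → Roots l
    roots []      = previous [] (roots-∈ o∈)
    roots (o ∷ l) = previous (o ∷ l) (roots l)

    everywhere : ∀ x → K (value x) → Z x
    everywhere (l , w , τ) = inside l (roots (after l)) τ

  -- Finiteness of the set of positions.

  joints : Listed Joint
  joints = listed-Vec (List.allFin _ , ∈-allFin) k

  mutual
    subtrees : ∀ {w} → Tree w → List (Σ State Tree)
    subtrees τ@(node real faith child) = (_ , τ) ∷ concatMap (λ v → subtrees? (child v)) (proj₁ joints)

    subtrees? : ∀ {w} → Maybe (Tree w) → List (Σ State Tree)
    subtrees? (just τ) = subtrees τ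
    subtrees? nothing  = []

  ∈-subtrees : ∀ {w} (τ : Tree w) → (w , τ) ∈ subtrees τ
  ∈-subtrees (node _ _ _) = here refl

  mutual
    subtrees-closed : ∀ {w u real faith child v τ′} (τ : Tree w) → (u , node real faith child) ∈ subtrees τ →
      child v ≡ just τ′ → (_ , τ′) ∈ subtrees τ
    subtrees-closed {child = child} {v} {τ′} (node _ _ _) (here refl) e =
      there (∈-concatMap⁺ (λ v → subtrees? (child v)) (lose (proj₂ joints v)
        (subst (λ τ? → (_ , τ′) ∈ subtrees? τ?) (sym e) (∈-subtrees τ′))))
    subtrees-closed (node _ _ child′) (there u∈) e =
      let v′ , _ , u∈′ = find (∈-concatMap⁻ (λ v → subtrees? (child′ v)) {xs = proj₁ joints} u∈) in
      there (∈-concatMap⁺ (λ v → subtrees? (child′ v))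
          (lose (proj₂ joints v′) (subtrees?-closed (child′ v′) u∈′ e)))

    subtrees?-closed : ∀ {w u real faith child v τ′} (τ? : Maybe (Tree w)) →
      (u , node real faith child) ∈ subtrees? τ? →
      child v ≡ just τ′ → (_ , τ′) ∈ subtrees? τ?
    subtrees?-closed (just τ) = subtrees-closed τ

  suffixes : List Obligation → List (List Obligation)
  suffixes []      = [] ∷ []
  suffixes (o ∷ l) = (o ∷ l) ∷ suffixes l

  ∈-suffixes : ∀ l → l ∈ suffixes l
  ∈-suffixes []      = here refl
  ∈-suffixes (_ ∷ _) = here refl

  []∈suffixes : ∀ l → [] ∈ suffixes l
  []∈suffixes []      = here refl
  []∈suffixes (_ ∷ l) = there ([]∈suffixes l)

  suffixes-tail : ∀ l {o l′} → (o ∷ l′) ∈ suffixes l → l′ ∈ suffixes l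
  suffixes-tail []      (here ())
  suffixes-tail (_ ∷ l) (here refl) = there (∈-suffixes l)
  suffixes-tail (_ ∷ l) (there l′∈) = there (suffixes-tail l l′∈)

  suffixes-after : ∀ l → l ∈ suffixes relevant → after l ∈ suffixes relevant
  suffixes-after []      _   = ∈-suffixes relevant
  suffixes-after (_ ∷ l) l∈ = suffixes-tail relevant l∈

  abstract
    -- A position with value `s₀` is added by hand: types do not record atoms, so the representative
    -- of the type of `s₀` may satisfy other formulas.
    roots : List Spot
    roots = ([] , s₀ , bare s₀) ∷ cartesianProductWith root (suffixes relevant) (proj₁ labels)

    ∈-roots : ∀ {l} t → l ∈ suffixes relevant → root l t ∈ roots
    ∈-roots t l∈ = there (∈-cartesianProductWith⁺ root l∈ (proj₂ labels t))

    roots-suffix : ∀ {x} → x ∈ roots → proj₁ x ∈ suffixes relevant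
    roots-suffix (here refl) = []∈suffixes relevant
    roots-suffix (there x∈) with ∈-cartesianProductWith⁻ root (suffixes relevant) (proj₁ labels) x∈
    ... | _ , _ , l∈ , _ , refl = l∈

    below : Spot → List Spot
    below (l , w , τ) = List.map (l ,_) (subtrees τ)

    spots : List Spot
    spots = concatMap below roots

    roots⊆spots : ∀ {x} → x ∈ roots → x ∈ spots
    roots⊆spots {l , w , τ} x∈ = ∈-concatMap⁺ below (lose x∈ (∈-map⁺ (l ,_) (∈-subtrees τ)))

    origin∈spots : ([] , s₀ , bare s₀) ∈ spots
    origin∈spots = roots⊆spots (here refl)

    -- A move to a child stays among the subtrees of the same root; any other move enters a root
    -- whose list is again a suffix of `relevant`.
    spots-closed : ∀ {x} → x ∈ spots → ∀ v → move x v ∈ spots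
    spots-closed {x} x∈ v with find (∈-concatMap⁻ below {xs = roots} x∈)
    ... | (l , w , τ) , r∈ , x∈′ with ∈-map⁻ (l ,_) x∈′
    ...   | (u , node real faith child) , u∈ , refl with child v in eq
    ...     | just τ′ = ∈-concatMap⁺ below (lose r∈ (∈-map⁺ (l ,_) (subtrees-closed τ u∈ eq)))
    ...     | nothing = roots⊆spots (∈-roots _ (suffixes-after l (roots-suffix r∈)))

-- The finite model and the obligations achievable in it.

module FiniteModel (em : ExcludedMiddle 0ℓ) {k : ℕ} {AP : Set} (M : Model k AP)
  (ρ : Model.State M → StateFormula k AP → Set) (css : List (List (Component k AP)))
  (s₀ : Model.State M) where

  open Monitor em k AP
  open Progress em k AP
  open Local em M ρ css
  open Trees em M ρ css
  open Unfolding em M ρ css s₀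

  Point : Set
  Point = Fin (List.length spots)

  spot : Point → Spot
  spot = List.lookup spots

  joint : All (λ _ → Refinement.Refinement Code (λ _ → ⊤)) (List.allFin k) → Joint
  joint ζ = Vec.tabulate (λ a → Refinement.value (tabulate⁻ {f = id} ζ a))

  origin : Point
  origin = index origin∈spots

  spot-origin : spot origin ≡ ([] , s₀ , bare s₀)
  spot-origin = sym (lookup-index origin∈spots)

  someCode : Code
  someCode = proj₁ (elect (Vec.replicate _ false))

  finite : Model k AP
  finite = record
    { State          = Point
    ; Act            = Code
    ; state-nonempty = origin
    ; Act-nonempty   = someCode
    ; game           = λ i → record
      { act          = λ _ _ → ⊤
      ; act-nonempty = λ _ → someCode , tt
      ; out          = λ ζ → index (spots-closed (∈-lookup i) (joint ζ))
      }
    ; V              = λ p i → Model.V M p (value (spot i))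
    }

  -- Monitors on the finite model read truth in the original one; `truth⇔` later identifies it with
  -- truth in the finite model, formula by formula.
  truth : Point → Truth
  truth i = ρ (value (spot i))

  module F  = Fixpoints em M ρ
  module F′ = Fixpoints em finite truth
  open Model.Game finite using (Profile; profile; out)

  spot-out : ∀ i ζ → spot (out i ζ) ≡ move (spot i) (joint ζ)
  spot-out i ζ = sym (lookup-index (spots-closed (∈-lookup i) (joint ζ)))

  enact : ∀ i → Joint → Profile i
  enact i v = profile i (λ a → Vec.lookup v a Refinement., Irrelevant.[ tt ])

  joint-enact : ∀ i v → joint (enact i v) ≡ v
  joint-enact i v = trans (Vecₚ.tabulate-cong λ a → cong Refinement.value (F′.choice-profile i _ a))
    (Vecₚ.tabulate∘lookup v)

  value-injective : {x y : Refinement.Refinement Code (λ _ → ⊤)} →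
    Refinement.value x ≡ Refinement.value y → x ≡ y
  value-injective refl = refl

  agree-joint : ∀ i {A} ζ ζ′ → F′.Agree i A ζ ζ′ → Agreeᶜ A (joint ζ) (joint ζ′)
  agree-joint i ζ ζ′ agr a a∈ = trans (Vecₚ.lookup∘tabulate _ a)
    (trans (cong Refinement.value (agr a a∈)) (sym (Vecₚ.lookup∘tabulate _ a)))

  agree-enact : ∀ i {A} ζ v → Agreeᶜ A (joint ζ) v → F′.Agree i A ζ (enact i v)
  agree-enact i ζ v agr a a∈ = value-injective (trans (sym (Vecₚ.lookup∘tabulate _ a))
    (trans (agr a a∈) (sym (cong Refinement.value (F′.choice-profile i _ a)))))

  -- Stating this and the next two facts for any `x` equal to `spot i` makes it possible to match on
  -- the tree in `x`.
  fail-at : ∀ {x o} i → spot i ≡ x → ¬ Sound (ρ (value x)) o → F′.Bad o i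
  fail-at i refl = F′.fail

  force-at : ∀ {x o} i → spot i ≡ x →
    (∀ v → Σ[ v′ ∈ Joint ] Σ[ A ∈ Subset k ] Agreeᶜ A v v′ ×
      (∀ j → spot j ≡ move x v′ → F′.Bad (next (ρ (value x)) A o) j)) →
    F′.Bad o i
  force-at i refl f = F′.force
    (λ ζ → enact i (proj₁ (f (joint ζ))))
    (λ ζ → proj₁ (proj₂ (f (joint ζ))))
    (λ ζ → agree-enact i ζ (proj₁ (f (joint ζ))) (proj₁ (proj₂ (proj₂ (f (joint ζ))))))
    (λ ζ → proj₂ (proj₂ (proj₂ (f (joint ζ)))) _
      (trans (spot-out i _) (cong (move (spot i)) (joint-enact i _))))

  later-at : ∀ {x o} i → spot i ≡ x → Sound (ρ (value x)) o → (v : Joint) →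
    (∀ v′ A → Agreeᶜ A v v′ → ∀ j → spot j ≡ move x v′ → F′.Achievable (next (ρ (value x)) A o) j) →
    F′.Achievable o i
  later-at i refl snd v f = F′.later snd (enact i v) λ ζ A agr →
    f (joint ζ) A (subst (λ v → Agreeᶜ A v (joint ζ)) (joint-enact i v) (agree-joint i (enact i v) ζ agr))
      (out i ζ) (spot-out i ζ)

  -- The moves given by `achieve` keep the obligation achievable all along the derivation of `Bad`,
  -- hence sound at its end.
  bad⇒¬achievable : ∀ {o i} → Relevant o → F′.Bad o i → ¬ F.Achievable o (value (spot i))
  bad⇒¬achievable rel (F′.fail ¬snd) ach = ¬snd (proj₁ (F.achievable⇒move ach))
  bad⇒¬achievable {o} {i} rel (F′.force reply A agr sub) ach =
    let v , f = achieve (spot i) rel ach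
        ζ = enact i v
    in bad⇒¬achievable (next-relevant (truth i) (A ζ) rel) (sub ζ)
         (subst (λ x → F.Achievable (next (truth i) (A ζ) o) (value x)) (sym (spot-out i (reply ζ)))
           (f (joint (reply ζ)) (A ζ)
             (subst (λ v → Agreeᶜ (A ζ) v (joint (reply ζ))) (joint-enact i v)
               (agree-joint i ζ (reply ζ) (agr ζ)))))

  -- By induction on the size: either the obligation changes and shrinks, or faithfulness keeps it
  -- unachievable until a tree serving it is entered, whose `Thwarts` derivation finishes.
  ¬achievable⇒bad : ∀ n {o} → size o < n → Relevant o → Accepting o →
    ∀ i → ¬ F.Achievable o (value (spot i)) → F′.Bad o i
  ¬achievable⇒bad (suc n) {o} (s≤s size≤n) rel acc i ¬ach = everywhere (spot i) ¬ach i refl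
    where
    onward : ∀ w A {x} → ¬ F.Achievable (next (ρ w) A o) (value x) →
      (next (ρ w) A o ≡ o → ∀ j → spot j ≡ x → F′.Bad o j) →
      ∀ j → spot j ≡ x → F′.Bad (next (ρ w) A o) j
    onward w A ¬ach stay j e with em {next (ρ w) A o ≡ o}
    ... | yes ≡o = subst (λ o → F′.Bad o j) (sym ≡o) (stay ≡o j e)
    ... | no  ≢o = ¬achievable⇒bad n (<-≤-trans (next-size-< (ρ w) A o ≢o) size≤n)
      (next-relevant (ρ w) A rel) (next-accepting (ρ w) A acc) j
      (subst (λ x → ¬ F.Achievable _ (value x)) (sym e) ¬ach)

    local : ∀ x → ¬ F.Achievable o (value x) →
      (∀ v → ¬ F.Achievable o (value (move x v)) → ∀ j → spot j ≡ move x v → F′.Bad o j) →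
      ∀ i → spot i ≡ x → F′.Bad o i
    local x ¬ach rec i e with em {Sound (ρ (value x)) o}
    ... | no ¬snd = fail-at i e ¬snd
    ... | yes snd = force-at i e λ v →
      let v′ , A , agr , ¬ach′ = oppose x rel snd ¬ach v in
      v′ , A , agr , onward (value x) A ¬ach′ λ ≡o →
        rec v′ (subst (λ o → ¬ F.Achievable o (value (move x v′))) ≡o ¬ach′)

    mutual
      thwarted : ∀ l {w} {τ : Tree w} → Thwarts o τ → ∀ i → spot i ≡ (l , w , τ) → F′.Bad o i
      thwarted l (unsound ¬snd) i e = fail-at i e ¬snd
      thwarted l {w} (thwarts {child = child} reply A agr ¬ach sub) i e = force-at i e λ v →
        reply v , A v , agr v , onward w (A v)
          (λ ach → ¬ach v (type-achievable (continue-type l (child (reply v))) (next-relevant (ρ w) (A v) rel) ach))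
          (λ ≡o → thwarted? l (sub v ≡o))

      thwarted? : ∀ l {w} {τ? : Maybe (Tree w)} → Any (Thwarts o) τ? → ∀ i → spot i ≡ continue l τ? → F′.Bad o i
      thwarted? l (just t) = thwarted l t

    open Cycle (∈-relevant rel) (λ w → ¬ F.Achievable o w) (λ x → ∀ i → spot i ≡ x → F′.Bad o i) local
      (λ l t ¬ach → thwarted (o ∷ l) (proj₁ (proj₂ (cultivate o (representative t))) rel acc ¬ach))

  -- An accepting obligation needs only the absence of `Bad`. Any other is kept achievable until it
  -- shrinks or a tree serving it is entered, and there `Pursues` gives the derivation.
  achievable-preserved : ∀ n {o} → size o < n → Relevant o →
    ∀ i → F.Achievable o (value (spot i)) → F′.Achievable o i
  achievable-preserved (suc n) {o} (s≤s size≤n) rel i ach with em {Accepting o}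
  ... | yes acc = F′.now acc (λ bad → bad⇒¬achievable rel bad ach)
  ... | no ¬acc = everywhere (spot i) ach i refl
    where
    onward : ∀ w A {x} → F.Achievable (next (ρ w) A o) (value x) →
      (next (ρ w) A o ≡ o → ∀ j → spot j ≡ x → F′.Achievable o j) →
      ∀ j → spot j ≡ x → F′.Achievable (next (ρ w) A o) j
    onward w A ach stay j e with em {next (ρ w) A o ≡ o}
    ... | yes ≡o = subst (λ o → F′.Achievable o j) (sym ≡o) (stay ≡o j e)
    ... | no  ≢o = achievable-preserved n (<-≤-trans (next-size-< (ρ w) A o ≢o) size≤n)
      (next-relevant (ρ w) A rel) j (subst (λ x → F.Achievable _ (value x)) (sym e) ach)

    local : ∀ x → F.Achievable o (value x) →
      (∀ v → F.Achievable o (value (move x v)) → ∀ j → spot j ≡ move x v → F′.Achievable o j) →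
      ∀ i → spot i ≡ x → F′.Achievable o i
    local x ach rec i e =
      let v , f = achieve x rel ach in
      later-at i e (proj₁ (F.achievable⇒move ach)) v λ v′ A agr →
        onward (value x) A (f v′ A agr) λ ≡o →
          rec v′ (subst (λ o → F.Achievable o (value (move x v′))) ≡o (f v′ A agr))

    mutual
      pursued : ∀ l {w} {τ : Tree w} → Pursues o τ → ∀ i → spot i ≡ (l , w , τ) → F′.Achievable o i
      pursued l {w} (pursues {child = child} snd v f sub) i e = later-at i e snd v λ v′ A agr →
        onward w A
          (type-achievable (sym (continue-type l (child v′))) (next-relevant (ρ w) A rel) (f v′ A agr))
          (λ ≡o → pursued? l (sub v′ A agr ≡o))

      pursued? : ∀ l {w} {τ? : Maybe (Tree w)} → Any (Pursues o) τ? → ∀ i → spot i ≡ continue l τ? →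
        F′.Achievable o i
      pursued? l (just p) = pursued l p

    open Cycle (∈-relevant rel) (F.Achievable o) (λ x → ∀ i → spot i ≡ x → F′.Achievable o i) local
      (λ l t ach → pursued (o ∷ l) (proj₂ (proj₂ (cultivate o (representative t))) rel ¬acc ach))

  -- In the `later` case the opposing joint move leads to an unachievable successor, against the
  -- induction hypothesis.
  achievable-reflected : ∀ {o i} → Relevant o → F′.Achievable o i → F.Achievable o (value (spot i))
  achievable-reflected {o} {i} rel (F′.now acc ¬bad) = stable λ ¬ach →
    ¬bad (¬achievable⇒bad (suc (size o)) ≤-refl rel acc i ¬ach)
  achievable-reflected {o} {i} rel (F′.later snd ζ f) = stable λ ¬ach →
    let v , A , agr , ¬ach′ = oppose (spot i) rel snd ¬ach (joint ζ) in
    ¬ach′ (subst (λ x → F.Achievable (next (truth i) A o) (value x))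
      (trans (spot-out i (enact i v)) (cong (move (spot i)) (joint-enact i v)))
      (achievable-reflected (next-relevant (truth i) A rel) (f (enact i v) A (agree-enact i ζ v agr))))

  transfer : ∀ {o} → Relevant o → ∀ i → F′.Achievable o i ⇔ F.Achievable o (value (spot i))
  transfer {o} rel i = mk⇔ (achievable-reflected rel) (achievable-preserved (suc (size o)) ≤-refl rel i)

-- The truth lemma.

module Goals (em : ExcludedMiddle 0ℓ) (k : ℕ) (AP : Set) where

  open Monitor em k AP
  open Progress em k AP
  open Translation em k AP

  mutual
    -- Collected over all nested goal assignments, so that each obligation met in `truth⇔` is
    -- relevant.
    goals : StateFormula k AP → List (List Comp)
    goals (atom p) = []
    goals ⊤ᶠ       = []
    goals (¬ᶠ φ)   = goals φ
    goals (φ ∧ᶠ ψ) = goals φ ++ goals ψ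
    goals (φ ∨ᶠ ψ) = goals φ ++ goals ψ
    goals ⟨[ γ ]⟩  = components (obligation γ) ∷ concatMap (λ C → goalsᵖ (γ C)) subsets

    goalsᵖ : PathFormula k AP → List (List Comp)
    goalsᵖ (X φ)    = goals φ
    goalsᵖ (φ U ψ)  = goals φ ++ goals ψ
    goalsᵖ (G φ)    = goals φ
    goalsᵖ (θ ∧ᵖ η) = goalsᵖ θ ++ goalsᵖ η

module TruthLemma (em : ExcludedMiddle 0ℓ) {k : ℕ} {AP : Set} (M : Model k AP)
  (css : List (List (Component k AP))) (s₀ : Model.State M) where

  open Monitor em k AP
  open Translation em k AP
  open Goals em k AP

  ρ : Model.State M → Truth
  ρ w φ = M , w ⊨ φ

  open Local em M ρ css using (Relevant)
  open Unfolding em M ρ css s₀ using (value)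
  open FiniteModel em M ρ css s₀

  path⇔ : ∀ π θ → (M , π ⊩ θ) ⇔ (ρ ∘ π ⊪ θ)
  path⇔ π (X φ)    = mk⇔ id id
  path⇔ π (φ U ψ)  = mk⇔ id id
  path⇔ π (G φ)    = mk⇔ id id
  path⇔ π (θ ∧ᵖ η) = path⇔ π θ ×-⇔ path⇔ π η

  mutual
    truth⇔ : ∀ φ → goals φ ⊆ˡ css → ∀ i → (finite , i ⊨ φ) ⇔ truth i φ
    truth⇔ (atom p) ⊆css i = mk⇔ id id
    truth⇔ ⊤ᶠ       ⊆css i = mk⇔ id id
    truth⇔ (¬ᶠ φ)   ⊆css i = let e = truth⇔ φ ⊆css i in
      mk⇔ (_∘ Equivalence.from e) (_∘ Equivalence.to e)
    truth⇔ (φ ∧ᶠ ψ) ⊆css i =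
      truth⇔ φ (⊆css ∘ ∈-++⁺ˡ) i ×-⇔ truth⇔ ψ (⊆css ∘ ∈-++⁺ʳ (goals φ)) i
    truth⇔ (φ ∨ᶠ ψ) ⊆css i =
      truth⇔ φ (⊆css ∘ ∈-++⁺ˡ) i ⊎-⇔ truth⇔ ψ (⊆css ∘ ∈-++⁺ʳ (goals φ)) i
    -- Read from right to left: strategies in the finite model become derivations there, these are
    -- transferred to `M`, and there they become strategies again.
    truth⇔ ⟨[ γ ]⟩  ⊆css i = ⇔-sym strategic-M ⇔-∘ (transfer (⊆css (here refl)) i ⇔-∘
      (strategic finite truth (λ _ ¬⊤ → ¬⊤ tt) γ i ⇔-∘ mk⇔
        (λ (Σ₀ , sat) → Σ₀ , λ C π π∈ → Equivalence.to (pathTruth⇔ (γ C) (γ⊆ C) π) (sat C π π∈))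
        (λ (Σ₀ , sat) → Σ₀ , λ C π π∈ → Equivalence.from (pathTruth⇔ (γ C) (γ⊆ C) π) (sat C π π∈))))
      where
      γ⊆ : ∀ C → goalsᵖ (γ C) ⊆ˡ css
      γ⊆ C x∈ = ⊆css (there (∈-concatMap⁺ (λ C → goalsᵖ (γ C)) (lose (proj₂ (listed-Vec listed-Bool k) C) x∈)))

      strategic-M : (M , value (spot i) ⊨ ⟨[ γ ]⟩) ⇔ F.Achievable (obligation γ) (value (spot i))
      strategic-M = strategic M ρ (λ _ ¬⊤ → ¬⊤ tt) γ (value (spot i)) ⇔-∘ mk⇔
        (λ (Σ₀ , sat) → Σ₀ , λ C π π∈ → Equivalence.to (path⇔ π (γ C)) (sat C π π∈))
        (λ (Σ₀ , sat) → Σ₀ , λ C π π∈ → Equivalence.from (path⇔ π (γ C)) (sat C π π∈))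

    pathTruth⇔ : ∀ θ → goalsᵖ θ ⊆ˡ css → ∀ π → (finite , π ⊩ θ) ⇔ (truth ∘ π ⊪ θ)
    pathTruth⇔ (X φ)    ⊆css π = truth⇔ φ ⊆css (π 1)
    pathTruth⇔ (φ U ψ)  ⊆css π = mk⇔
      (λ (i , ψi , φj) → i , Equivalence.to (ψ⇔ i) ψi , λ j j<i → Equivalence.to (φ⇔ j) (φj j j<i))
      (λ (i , ψi , φj) → i , Equivalence.from (ψ⇔ i) ψi , λ j j<i → Equivalence.from (φ⇔ j) (φj j j<i))
      where
      φ⇔ = λ j → truth⇔ φ (⊆css ∘ ∈-++⁺ˡ) (π j)
      ψ⇔ = λ j → truth⇔ ψ (⊆css ∘ ∈-++⁺ʳ (goals φ)) (π j)
    pathTruth⇔ (G φ)    ⊆css π = mk⇔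
      (λ all j → Equivalence.to (truth⇔ φ ⊆css (π j)) (all j))
      (λ all j → Equivalence.from (truth⇔ φ ⊆css (π j)) (all j))
    pathTruth⇔ (θ ∧ᵖ η) ⊆css π =
      pathTruth⇔ θ (⊆css ∘ ∈-++⁺ˡ) π ×-⇔ pathTruth⇔ η (⊆css ∘ ∈-++⁺ʳ (goalsᵖ θ)) π

theorem9 : ExcludedMiddle 0ℓ →
    (k : ℕ) (AP : Set) (φ : StateFormula k AP) →
    Satisfiable φ →
    Σ[ M ∈ Model k AP ]
      Finite (Model.State M) × Finite (Model.Act M) × SatisfiableIn M φ
theorem9 em k AP φ (M , s , s⊨φ) =
  -- The value at `origin` is `s` itself, so `φ` is true there.
  finite , (_ , ↔-id _) , (_ , ↔-id _) , origin ,
    Equivalence.from (truth⇔ φ id origin) (subst (λ x → M , value x ⊨ φ) (sym spot-origin) s⊨φ)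
  where
  open Goals em k AP
  open TruthLemma em M (goals φ) s
  open Unfolding em M ρ (goals φ) s using (value)
  open FiniteModel em M ρ (goals φ) s
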